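{- Let $S$ be a finite set of points in the plane and let $\mathcal{F}$ be the family of all (closed) halfplanes. Then the Delaunay-edges of $S$ with respect to $\mathcal{F}$ can be $2$-colored such that every halfplane that contains at least three Delaunay-edges contains two Delaunay-edges of different colors. Moreover, this statement becomes false if "three" is replaced by "two": there exists a finite point set $S$ in the plane whose Delaunay-edges with respect to halfplanes admit no $2$-coloring in which every halfplane containing at least two Delaunay-edges contains two Delaunay-edges of different colors.
   Context: A Delaunay-edge of $S$ with respect to a family of regions $\mathcal{F}$ is a pair $\{p,q\}\subseteq S$ such that there exists $F\in\mathcal{F}$ with $F\cap S=\{p,q\}$. A region contains a Delaunay-edge if it contains both of its endpoints. -}

module Defs where

open import Level using (0ℓ)
open import Data.Bool using (Bool)
open import Data.Product using (Σ; ∃; ∃-syntax; _×_; _,_)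
open import Data.Sum using (_⊎_)
open import Data.List using (List)
open import Data.List.Membership.Propositional using (_∈_)
open import Data.List.Relation.Unary.Unique.Propositional using (Unique)
open import Relation.Nullary using (¬_)
open import Relation.Binary using (IsTotalOrder; Decidable)
open import Relation.Binary.PropositionalEquality using (_≡_; _≢_)
open import Algebra.Structures using (IsCommutativeRing)
open import Function.Bundles using (_⇔_)

-- The real numbers, axiomatised as a (Dedekind-)complete ordered field.
-- (Categorical classically, so quantifying over all models = talking about ℝ.)
-- Decidability of ≤ is included (true classically for ℝ).
record RealField : Set₁ where
  infixl 6 _+_
  infixl 7 _*_
  infix 4 _≤_
  field
    Carrier : Set
    0# 1# : Carrier
    _+_ _*_ : Carrier → Carrier → Carrier
    -_ : Carrier → Carrier
    isCommutativeRing : IsCommutativeRing _≡_ _+_ _*_ -_ 0# 1#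
    0≢1 : 0# ≢ 1#
    inverse : ∀ x → x ≢ 0# → ∃[ y ] (x * y ≡ 1#)
    _≤_ : Carrier → Carrier → Set
    isTotalOrder : IsTotalOrder _≡_ _≤_
    _≤?_ : Decidable _≤_
    +-mono-≤ : ∀ {x y} z → x ≤ y → x + z ≤ y + z
    *-nonneg : ∀ {x y} → 0# ≤ x → 0# ≤ y → 0# ≤ x * y
    complete : (P : Carrier → Set) → ∃ P → ∃[ b ] (∀ x → P x → x ≤ b) →
               ∃[ s ] ((∀ x → P x → x ≤ s) × (∀ b → (∀ x → P x → x ≤ b) → s ≤ b))

module Plane (R : RealField) where
  open RealField R

  Point : Set
  Point = Carrier × Carrier

  record Halfplane : Set where
    constructor halfplane
    field
      a b c : Carrier
      nondeg : ¬ (a ≡ 0# × b ≡ 0#)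

  _∈H_ : Point → Halfplane → Set
  (x , y) ∈H halfplane a b c _ = c ≤ a * x + b * y

  DelaunayEdge : List Point → Point → Point → Set
  DelaunayEdge S p q = p ≢ q × p ∈ S × q ∈ S ×
    ∃[ H ] (∀ r → r ∈ S → (r ∈H H ⇔ (r ≡ p ⊎ r ≡ q)))

  SameEdge : Point → Point → Point → Point → Set
  SameEdge p q p' q' = (p ≡ p' × q ≡ q') ⊎ (p ≡ q' × q ≡ p')

  ContainsEdge : List Point → Halfplane → Point → Point → Set
  ContainsEdge S H p q = DelaunayEdge S p q × p ∈H H × q ∈H H

  ContainsAtLeast2 : List Point → Halfplane → Set
  ContainsAtLeast2 S H = ∃[ p₁ ] ∃[ q₁ ] ∃[ p₂ ] ∃[ q₂ ]
    (ContainsEdge S H p₁ q₁ × ContainsEdge S H p₂ q₂ × ¬ SameEdge p₁ q₁ p₂ q₂)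

  ContainsAtLeast3 : List Point → Halfplane → Set
  ContainsAtLeast3 S H = ∃[ p₁ ] ∃[ q₁ ] ∃[ p₂ ] ∃[ q₂ ] ∃[ p₃ ] ∃[ q₃ ]
    (ContainsEdge S H p₁ q₁ × ContainsEdge S H p₂ q₂ × ContainsEdge S H p₃ q₃ ×
     ¬ SameEdge p₁ q₁ p₂ q₂ × ¬ SameEdge p₁ q₁ p₃ q₃ × ¬ SameEdge p₂ q₂ p₃ q₃)

  Colouring : Set
  Colouring = Point → Point → Bool

  WellDefinedColouring : List Point → Colouring → Set
  WellDefinedColouring S χ = ∀ p q → DelaunayEdge S p q → χ p q ≡ χ q p

  Bichromatic : List Point → Colouring → Halfplane → Set
  Bichromatic S χ H = ∃[ p ] ∃[ q ] ∃[ p' ] ∃[ q' ]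
    (ContainsEdge S H p q × ContainsEdge S H p' q' × χ p q ≢ χ p' q')

{-# OPTIONS --safe #-}

-- Rotate a direction once around the circle, clockwise, and order the Delaunay-edges by the
-- directions in which their endpoints are the two extreme points of S.  The edges inside a
-- halfplane H with normal u are consecutive in this cyclic order: if p, q ∈ H are extreme in
-- direction v, and x lies on the shorter arc from v to u, then p and q beat every point outside H
-- in direction x as well, so the edge of direction x is inside H.
-- Colour the edges alternately, starting at some cut of the cycle.  Only the two edges next to the
-- cut can be neighbours of the same colour, so three consecutive edges are never monochromatic.
-- For the second part take a convex pentagon: its Delaunay-edges are its five sides, and any two
-- neighbouring sides are the only edges inside some halfplane, so that a colouring would be a
-- proper 2-colouring of a 5-cycle.

module Submission where

open import Defs
open import Algebra.Bundles using (CommutativeRing)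
open import Algebra.Solver.Ring.AlmostCommutativeRing using (fromCommutativeRing; _-Raw-AlmostCommutative⟶_)
open import Data.Bool using (Bool; true; false; if_then_else_; not)
open import Data.Bool.Properties using (not-injective; ¬-not; not-involutive)
open import Data.Empty using (⊥; ⊥-elim)
open import Data.Fin using (Fin)
open import Data.Fin.Patterns
import Data.Fin.Properties as Fin
open import Data.Integer as ℤ using (ℤ; -[1+_]; -1ℤ; 0ℤ; 1ℤ)
import Data.Integer.Properties as ℤ
open import Data.List
  using (List; []; _∷_; _++_; map; filter; concatMap; cartesianProduct; deduplicate; tabulate)
import Data.List.Membership.DecPropositional as DecMembership
open import Data.List.Membership.Propositional using (_∈_; find)
open import Data.List.Membership.Propositional.Properties
  using (∈-cartesianProduct⁺; ∈-filter⁺; ∈-filter⁻; ∈-map⁺; ∈-tabulate⁺; ∈-tabulate⁻)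
open import Data.List.Relation.Binary.Permutation.Propositional using (↭-sym)
open import Data.List.Relation.Binary.Permutation.Propositional.Properties using (Any-resp-↭)
open import Data.List.Relation.Binary.Sublist.Propositional using (_⊆_; []; _∷_; _∷ʳ_)
open import Data.List.Relation.Binary.Sublist.Propositional.Properties using (filter-⊆; All-resp-⊆)
open import Data.List.Relation.Unary.All as All using (All; []; _∷_)
import Data.List.Relation.Unary.All.Properties as All
open import Data.List.Relation.Unary.AllPairs as AllPairs using (AllPairs; []; _∷_)
import Data.List.Relation.Unary.AllPairs.Properties as AllPairs
open import Data.List.Relation.Unary.Any as Any using (Any; here; there; any?)
import Data.List.Relation.Unary.Any.Properties as Any
open import Data.List.Relation.Unary.Sorted.TotalOrder.Properties using (Sorted⇒AllPairs)
open import Data.List.Relation.Unary.Unique.Propositional using (Unique)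
import Data.List.Relation.Unary.Unique.Propositional.Properties as Unique
import Data.List.Sort as Sort
import Data.Maybe as Maybe
open import Data.Nat as ℕ using (ℕ; zero; suc)
import Data.Nat.Properties as ℕ
open import Data.Product using (Σ; ∃-syntax; _×_; _,_; proj₁; proj₂; uncurry)
open import Data.Product.Properties using (≡-dec)
open import Data.Sum as Sum using (_⊎_; inj₁; inj₂; [_,_]′)
open import Data.Sum.Relation.Binary.LeftOrder using (_⊎-<_; ₁∼₂; ₁∼₁; ₂∼₂; ⊎-<-decTotalOrder)
open import Function using (_∘_; _$_; id; flip)
open import Function.Bundles using (_⇔_; mk⇔; Equivalence)
open import Level using (Level; 0ℓ)
open import Relation.Binary
  using (Rel; REL; Decidable; DecidableEquality; DecTotalOrder; IsTotalOrder; Reflexive; Total; Transitive)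
import Relation.Binary.Construct.On as On
open import Relation.Binary.PropositionalEquality hiding (J)
open import Relation.Nullary using (¬_; Dec; yes; no; contradiction; does)
open import Relation.Nullary.Decidable
  using (decidable-stable; dec⇒maybe; does-⇔; from-yes; map′; ¬?; _⊎-dec_; _×-dec_; _→-dec_)
open import Relation.Unary as Unary using (Pred)

-- Lists: entries satisfying a predicate, and alternating colours along a list.

private
  variable
    ℓ ℓ₁ : Level
    A : Set ℓ₁

data Adjacent {A : Set ℓ₁} (x y : A) : List A → Set ℓ₁ where
  here  : ∀ {zs} → Adjacent x y (x ∷ y ∷ zs)
  there : ∀ {z zs} → Adjacent x y zs → Adjacent x y (z ∷ zs)

Adjacent⇒∈ : ∀ {x y : A} {zs} → Adjacent x y zs → x ∈ zs × y ∈ zs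
Adjacent⇒∈ here        = here refl , there (here refl)
Adjacent⇒∈ (there adj) = let (x∈ , y∈) = Adjacent⇒∈ adj in there x∈ , there y∈

AllPairs-resp-⊆ : {R : Rel A ℓ} {xs ys : List A} → xs ⊆ ys → AllPairs R ys → AllPairs R xs
AllPairs-resp-⊆ []         []       = []
AllPairs-resp-⊆ (_ ∷ʳ sub) (_ ∷ ps) = AllPairs-resp-⊆ sub ps
AllPairs-resp-⊆ (refl ∷ sub) (p ∷ ps) = All-resp-⊆ sub p ∷ AllPairs-resp-⊆ sub ps

module _ {R : Rel A ℓ} (R? : Decidable R) where

  deduplicate-AllPairs : ∀ {ℓ′} {Q : Rel A ℓ′} {xs} → AllPairs Q xs → AllPairs Q (deduplicate R? xs)
  deduplicate-AllPairs []       = []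
  deduplicate-AllPairs (p ∷ ps) =
    All.filter⁺ _ (All.deduplicate⁺ R? p) ∷ AllPairs.filter⁺ _ (deduplicate-AllPairs ps)

  deduplicate-! : ∀ xs → AllPairs (λ x y → ¬ R x y) (deduplicate R? xs)
  deduplicate-! []       = []
  deduplicate-! (x ∷ xs) = All.all-filter _ (deduplicate R? xs) ∷ AllPairs.filter⁺ _ (deduplicate-! xs)

module _ {P : Pred A ℓ} (P? : Unary.Decidable P) where

  -- The witnesses are the first three entries of the filtered list, because `e`, `f` and `g` may
  -- occur in `xs` in any order. If the filtered list had fewer than three entries, two of `e`, `f`,
  -- `g` would coincide.
  three⊆ : ∀ {e f g} {xs : List A} → e ∈ xs → f ∈ xs → g ∈ xs → P e → P f → P g →
    e ≢ f → e ≢ g → f ≢ g →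
    ∃[ x ] ∃[ y ] ∃[ z ] ∃[ zs ] (P x × P y × P z × x ∷ y ∷ z ∷ zs ⊆ xs)
  three⊆ {e} {f} {g} {xs} e∈ f∈ g∈ Pe Pf Pg e≢f e≢g f≢g
    with filter P? xs | filter-⊆ P? xs | All.all-filter P? xs
       | ∈-filter⁺ P? e∈ Pe | ∈-filter⁺ P? f∈ Pf | ∈-filter⁺ P? g∈ Pg
  ... | x ∷ y ∷ z ∷ zs | sub | Px ∷ Py ∷ Pz ∷ _ | _ | _ | _ = x , y , z , zs , Px , Py , Pz , sub
  ... | x ∷ []     | _ | _ | here refl | here refl | _ = contradiction refl e≢f
  ... | x ∷ y ∷ [] | _ | _ | here refl | here refl | _ = contradiction refl e≢f
  ... | x ∷ y ∷ [] | _ | _ | here refl | there (here refl) | here refl = contradiction refl e≢g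
  ... | x ∷ y ∷ [] | _ | _ | here refl | there (here refl) | there (here refl) = contradiction refl f≢g
  ... | x ∷ y ∷ [] | _ | _ | there (here refl) | here refl | here refl = contradiction refl f≢g
  ... | x ∷ y ∷ [] | _ | _ | there (here refl) | here refl | there (here refl) = contradiction refl e≢g
  ... | x ∷ y ∷ [] | _ | _ | there (here refl) | there (here refl) | _ = contradiction refl e≢f

  AdjacentIn : List A → Set _
  AdjacentIn xs = ∃[ x ] ∃[ y ] (Adjacent x y xs × P x × P y)

  thereIn : ∀ {z xs} → AdjacentIn xs → AdjacentIn (z ∷ xs)
  thereIn (x , y , adj , Pxy) = x , y , there adj , Pxy

  -- Look at the entry of `xs` right after `y`: if it satisfies `P`, it forms an adjacent pair with
  -- `y`; if not, it can be inserted between `y` and `z`. The prefix `zs` keeps the entries found by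
  -- an earlier application.
  separate : ∀ zs {y z ws xs} → P y → P z → zs ++ y ∷ z ∷ ws ⊆ xs →
    AdjacentIn xs ⊎ ∃[ x ] (¬ P x × zs ++ y ∷ x ∷ z ∷ ws ⊆ xs)
  separate [] {y} {z} Py Pz (refl ∷ (refl ∷ sub)) = inj₁ (y , z , here , Py , Pz)
  separate [] {y} Py Pz (refl ∷ (v ∷ʳ sub)) with P? v
  ... | yes Pv = inj₁ (y , v , here , Py , Pv)
  ... | no ¬Pv = inj₂ (v , ¬Pv , refl ∷ (refl ∷ sub))
  separate [] Py Pz (v ∷ʳ sub) =
    Sum.map thereIn (λ (x , ¬Px , sub′) → x , ¬Px , v ∷ʳ sub′) (separate [] Py Pz sub)
  separate zs@(_ ∷ _) Py Pz (v ∷ʳ sub) =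
    Sum.map thereIn (λ (x , ¬Px , sub′) → x , ¬Px , v ∷ʳ sub′) (separate zs Py Pz sub)
  separate (_ ∷ zs) Py Pz (refl ∷ sub) =
    Sum.map thereIn (λ (x , ¬Px , sub′) → x , ¬Px , refl ∷ sub′) (separate zs Py Pz sub)

  -- Three entries satisfying `P` leave two gaps, and `separate` treats one after the other. The
  -- third entry serves only to place `y` and then disappears into the tail `zs`.
  alternation : ∀ {e f g} {xs : List A} → e ∈ xs → f ∈ xs → g ∈ xs → P e → P f → P g →
    e ≢ f → e ≢ g → f ≢ g →
    AdjacentIn xs ⊎
    ∃[ v ] ∃[ x ] ∃[ w ] ∃[ y ] ∃[ zs ] (P v × ¬ P x × P w × ¬ P y × v ∷ x ∷ w ∷ y ∷ zs ⊆ xs)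
  alternation e∈ f∈ g∈ Pe Pf Pg e≢f e≢g f≢g
    with three⊆ e∈ f∈ g∈ Pe Pf Pg e≢f e≢g f≢g
  ... | v , w , z , _ , Pv , Pw , Pz , sub with separate [] Pv Pw sub
  ...   | inj₁ adj = inj₁ adj
  ...   | inj₂ (x , ¬Px , sub′) with separate (v ∷ x ∷ []) Pw Pz sub′
  ...     | inj₁ adj = inj₁ adj
  ...     | inj₂ (y , ¬Py , sub″) = inj₂ (v , x , w , y , _ , Pv , ¬Px , Pw , ¬Py , sub″)

module _ {b} {B : Set b} {R : REL A B ℓ} (R? : Decidable R) where

  -- The parity of the index of the first entry related to `y`. The value at the empty list is a
  -- default for a `y` that is related to no entry.
  alternate : List A → B → Bool
  alternate []       _ = false
  alternate (x ∷ xs) y = if does (R? x y) then true else not (alternate xs y)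

  alternate-cong : ∀ {y z} → (∀ x → R x y ⇔ R x z) → ∀ xs → alternate xs y ≡ alternate xs z
  alternate-cong eq []       = refl
  alternate-cong {y} {z} eq (x ∷ xs) =
    cong₂ (if_then true else_) (does-⇔ (eq x) (R? x y) (R? x z)) (cong not (alternate-cong eq xs))

  -- No entry is related to the key of a later one, so the search for the key of an entry stops
  -- exactly at that entry; the indices of neighbours differ by one.
  alternate-adjacent : (key : A → B) → (∀ x → R x (key x)) →
    ∀ {x y zs} → AllPairs (λ x y → ¬ R x (key y)) zs → Adjacent x y zs →
    alternate zs (key x) ≢ alternate zs (key y)
  alternate-adjacent key R-key {x} {y} ((¬Rxy ∷ _) ∷ _) here eq
    with R? x (key x) | R? x (key y) | R? y (key y)
  ... | no ¬Rxx | _       | _       = ¬Rxx (R-key x)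
  ... | yes _   | yes Rxy | _       = ¬Rxy Rxy
  ... | yes _   | no _    | no ¬Ryy = ¬Ryy (R-key y)
  ... | yes _   | no _    | yes _   with () ← eq
  alternate-adjacent key R-key {x} {y} {z ∷ zs} (¬Rz ∷ ps) (there adj) eq
    with R? z (key x) | R? z (key y) | Adjacent⇒∈ adj
  ... | yes Rzx | _       | x∈ , _ = All.lookup ¬Rz x∈ Rzx
  ... | no _    | yes Rzy | _ , y∈ = All.lookup ¬Rz y∈ Rzy
  ... | no _    | no _    | _      = alternate-adjacent key R-key ps adj (not-injective eq)

-- Ordered field arithmetic and the embedding of the integers.

module OrderedField (R : RealField) where

  open RealField R public hiding (complete)
  open IsTotalOrder isTotalOrder public
    using (antisym; total) renaming (refl to ≤-refl; trans to ≤-trans; reflexive to ≤-reflexive)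

  commutativeRing : CommutativeRing _ _
  commutativeRing = record { isCommutativeRing = isCommutativeRing }

  open CommutativeRing commutativeRing
    using (ring; semiring; _-_; +-comm; +-assoc; +-identityˡ; +-identityʳ; *-identityˡ; *-assoc;
           zeroʳ; -‿inverseʳ) public
  open import Algebra.Properties.Ring ring using (-‿distribˡ-*; -‿distribʳ-*; -‿involutive; -0#≈0#; -‿+-comm)
  open import Algebra.Properties.Semiring.Mult.TCOptimised semiring
    using (1+×; ×-homo-+; ×1-homo-*) renaming (_×_ to _×ₙ_)

  -- Integer coefficients have decidable equality, which lets the ring solver compare normal forms.
  -- The same map later places the lattice pentagon in the plane.
  ι : ℤ → Carrier
  ι (ℤ.+ n)  = n ×ₙ 1#
  ι -[1+ n ] = - (suc n ×ₙ 1#)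

  ι-neg : ∀ m → ι (ℤ.- m) ≡ - ι m
  ι-neg (ℤ.+ zero)  = sym -0#≈0#
  ι-neg (ℤ.+ suc n) = refl
  ι-neg -[1+ n ]    = sym (-‿involutive _)

  ι-⊖ : ∀ m n → ι (m ℤ.⊖ n) ≡ (m ×ₙ 1#) + - (n ×ₙ 1#)
  ι-⊖ zero    zero    = sym (-‿inverseʳ 0#)
  ι-⊖ zero    (suc n) = sym (+-identityˡ _)
  ι-⊖ (suc m) zero    = sym (trans (cong ((suc m ×ₙ 1#) +_) -0#≈0#) (+-identityʳ _))
  ι-⊖ (suc m) (suc n) = begin
    ι (suc m ℤ.⊖ suc n)           ≡⟨ cong ι (ℤ.[1+m]⊖[1+n]≡m⊖n m n) ⟩
    ι (m ℤ.⊖ n)                   ≡⟨ ι-⊖ m n ⟩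
    x + - y                       ≡⟨ cong (_+ - y) (sym (+-identityʳ x)) ⟩
    -- Inserting `1# + - 1#` supplies the two units that turn `x` and `y` into the successor
    -- multiples.
    x + 0# + - y                  ≡⟨ cong (λ z → x + z + - y) (sym (-‿inverseʳ 1#)) ⟩
    x + (1# + - 1#) + - y         ≡⟨ cong (_+ - y) (sym (+-assoc x 1# (- 1#))) ⟩
    x + 1# + - 1# + - y           ≡⟨ +-assoc _ _ _ ⟩
    x + 1# + (- 1# + - y)         ≡⟨ cong₂ _+_ (+-comm x 1#) (-‿+-comm 1# y) ⟩
    1# + x + - (1# + y)           ≡⟨ sym (cong₂ (λ u v → u + - v) (1+× m 1#) (1+× n 1#)) ⟩
    (suc m ×ₙ 1#) + - (suc n ×ₙ 1#) ∎
    where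
    open ≡-Reasoning
    x = m ×ₙ 1#
    y = n ×ₙ 1#

  ι-+ : ∀ m n → ι (m ℤ.+ n) ≡ ι m + ι n
  ι-+ (ℤ.+ m)  (ℤ.+ n)  = ×-homo-+ 1# m n
  ι-+ (ℤ.+ m)  -[1+ n ] = ι-⊖ m (suc n)
  ι-+ -[1+ m ] (ℤ.+ n)  = trans (ι-⊖ n (suc m)) (+-comm _ _)
  ι-+ -[1+ m ] -[1+ n ] = begin
    - (suc (suc (m ℕ.+ n)) ×ₙ 1#)         ≡⟨ cong (λ k → - (suc k ×ₙ 1#)) (sym (ℕ.+-suc m n)) ⟩
    - ((suc m ℕ.+ suc n) ×ₙ 1#)           ≡⟨ cong -_ (×-homo-+ 1# (suc m) (suc n)) ⟩
    - ((suc m ×ₙ 1#) + (suc n ×ₙ 1#))     ≡⟨ sym (-‿+-comm _ _) ⟩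
    - (suc m ×ₙ 1#) + - (suc n ×ₙ 1#)     ∎
    where
    open ≡-Reasoning

  ι-*-nonneg : ∀ m n → ι (ℤ.+ m ℤ.* n) ≡ ι (ℤ.+ m) * ι n
  ι-*-nonneg m (ℤ.+ n)  = trans (cong ι (sym (ℤ.pos-* m n))) (×1-homo-* m n)
  ι-*-nonneg m -[1+ n ] = begin
    ι (ℤ.+ m ℤ.* ℤ.- (ℤ.+ suc n))    ≡⟨ cong ι (sym (ℤ.neg-distribʳ-* (ℤ.+ m) (ℤ.+ suc n))) ⟩
    ι (ℤ.- (ℤ.+ m ℤ.* ℤ.+ suc n))    ≡⟨ ι-neg (ℤ.+ m ℤ.* ℤ.+ suc n) ⟩
    - ι (ℤ.+ m ℤ.* ℤ.+ suc n)        ≡⟨ cong -_ (ι-*-nonneg m (ℤ.+ suc n)) ⟩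
    - (ι (ℤ.+ m) * ι (ℤ.+ suc n))    ≡⟨ -‿distribʳ-* _ _ ⟩
    ι (ℤ.+ m) * ι -[1+ n ]           ∎
    where open ≡-Reasoning

  ι-* : ∀ m n → ι (m ℤ.* n) ≡ ι m * ι n
  ι-* (ℤ.+ m)  n = ι-*-nonneg m n
  ι-* -[1+ m ] n = begin
    ι (ℤ.- (ℤ.+ suc m) ℤ.* n)        ≡⟨ cong ι (sym (ℤ.neg-distribˡ-* (ℤ.+ suc m) n)) ⟩
    ι (ℤ.- (ℤ.+ suc m ℤ.* n))        ≡⟨ ι-neg (ℤ.+ suc m ℤ.* n) ⟩
    - ι (ℤ.+ suc m ℤ.* n)            ≡⟨ cong -_ (ι-*-nonneg (suc m) n) ⟩
    - (ι (ℤ.+ suc m) * ι n)          ≡⟨ -‿distribˡ-* _ _ ⟩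
    ι -[1+ m ] * ι n                 ∎
    where open ≡-Reasoning

  ι-morphism : ℤ.+-*-rawRing -Raw-AlmostCommutative⟶ fromCommutativeRing commutativeRing
  ι-morphism = record
    { ⟦_⟧ = ι ; +-homo = ι-+ ; *-homo = ι-* ; -‿homo = ι-neg ; 0-homo = refl ; 1-homo = refl }

  module RingSolver where
    open import Algebra.Solver.Ring ℤ.+-*-rawRing (fromCommutativeRing commutativeRing) ι-morphism
      (λ m n → Maybe.map (cong ι) (dec⇒maybe (m ℤ.≟ n))) public
  open RingSolver using (solve; _:=_; _:+_; _:*_; _:-_; :-_; con)

  infix 4 _<_ _<?_ _≟_
  _<_ : Carrier → Carrier → Set
  x < y = ¬ (y ≤ x)

  _<?_ : Decidable _<_
  x <? y = ¬? (y ≤? x)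

  _≟_ : DecidableEquality Carrier
  x ≟ y with x ≤? y | y ≤? x
  ... | yes x≤y | yes y≤x = yes (antisym x≤y y≤x)
  ... | no x≰y  | _       = no λ { refl → x≰y ≤-refl }
  ... | _       | no y≰x  = no λ { refl → y≰x ≤-refl }

  <⇒≤ : ∀ {x y} → x < y → x ≤ y
  <⇒≤ {x} {y} x<y = [ id , (λ y≤x → contradiction y≤x x<y) ]′ (total x y)

  <-irrefl : ∀ {x} → ¬ x < x
  <-irrefl x<x = x<x ≤-refl

  ≤-<-trans : ∀ {x y z} → x ≤ y → y < z → x < z
  ≤-<-trans x≤y y<z z≤x = y<z (≤-trans z≤x x≤y)

  <-≤-trans : ∀ {x y z} → x < y → y ≤ z → x < z
  <-≤-trans x<y y≤z z≤x = x<y (≤-trans y≤z z≤x)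

  <-trans : ∀ {x y z} → x < y → y < z → x < z
  <-trans x<y y<z = <-≤-trans x<y (<⇒≤ y<z)

  ≤∧≢⇒< : ∀ {x y} → x ≤ y → x ≢ y → x < y
  ≤∧≢⇒< x≤y x≢y y≤x = x≢y (antisym x≤y y≤x)

  x≤y⇒0≤y-x : ∀ {x y} → x ≤ y → 0# ≤ y - x
  x≤y⇒0≤y-x {x} {y} x≤y = subst (_≤ y - x) (-‿inverseʳ x) (+-mono-≤ (- x) x≤y)

  0≤y-x⇒x≤y : ∀ {x y} → 0# ≤ y - x → x ≤ y
  0≤y-x⇒x≤y {x} {y} 0≤y-x = subst₂ _≤_ (+-identityˡ x)
    (solve 2 (λ x y → y :- x :+ x := y) refl x y) (+-mono-≤ x 0≤y-x)

  x<y⇒0<y-x : ∀ {x y} → x < y → 0# < y - x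
  x<y⇒0<y-x {x} {y} x<y y-x≤0 = x<y $ subst₂ _≤_
    (solve 2 (λ x y → y :- x :+ x := y) refl x y) (+-identityˡ x) (+-mono-≤ x y-x≤0)

  0<y-x⇒x<y : ∀ {x y} → 0# < y - x → x < y
  0<y-x⇒x<y {x} {y} 0<y-x y≤x = 0<y-x (subst (y - x ≤_) (-‿inverseʳ x) (+-mono-≤ (- x) y≤x))

  0≤-⁺ : ∀ {x} → x ≤ 0# → 0# ≤ - x
  0≤-⁺ {x} x≤0 = subst (0# ≤_) (+-identityˡ (- x)) (x≤y⇒0≤y-x x≤0)

  0<-⁺ : ∀ {x} → x < 0# → 0# < - x
  0<-⁺ {x} x<0 = subst (0# <_) (+-identityˡ (- x)) (x<y⇒0<y-x x<0)

  +-nonneg : ∀ {x y} → 0# ≤ x → 0# ≤ y → 0# ≤ x + y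
  +-nonneg {x} {y} 0≤x 0≤y = ≤-trans 0≤y (subst (_≤ x + y) (+-identityˡ y) (+-mono-≤ y 0≤x))

  +-pos-nonneg : ∀ {x y} → 0# < x → 0# ≤ y → 0# < x + y
  +-pos-nonneg {x} {y} 0<x 0≤y x+y≤0 = 0<x $ ≤-trans
    (subst₂ _≤_ (+-identityˡ x) (+-comm y x) (+-mono-≤ x 0≤y)) x+y≤0

  -- Otherwise the product, being also nonnegative, is zero, and multiplying by the inverse of `x`
  -- gives `y ≡ 0#`.
  *-pos : ∀ {x y} → 0# < x → 0# < y → 0# < x * y
  *-pos {x} {y} 0<x 0<y xy≤0 = 0<y (≤-reflexive y≡0)
    where
    open ≡-Reasoning
    xy≡0 = antisym xy≤0 (*-nonneg (<⇒≤ 0<x) (<⇒≤ 0<y))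
    x⁻¹ = inverse x (λ { refl → <-irrefl 0<x })
    y≡0 : y ≡ 0#
    y≡0 = begin
      y                    ≡⟨ sym (*-identityˡ y) ⟩
      1# * y               ≡⟨ cong (_* y) (sym (proj₂ x⁻¹)) ⟩
      x * proj₁ x⁻¹ * y    ≡⟨ solve 3 (λ x z y → x :* z :* y := z :* (x :* y)) refl x (proj₁ x⁻¹) y ⟩
      proj₁ x⁻¹ * (x * y)  ≡⟨ cong (proj₁ x⁻¹ *_) xy≡0 ⟩
      proj₁ x⁻¹ * 0#       ≡⟨ zeroʳ _ ⟩
      0#                   ∎

  -- If `y ≤ 0#`, then `x * (- y)` is nonnegative, against `0# < x * y`. The factor `x` may be zero,
  -- as `κ` may be in `cone`.
  *-cancel-pos : ∀ {x y} → 0# ≤ x → 0# < x * y → 0# < y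
  *-cancel-pos {x} {y} 0≤x 0<xy y≤0 = 0<xy $ subst (_≤ 0#)
    (solve 2 (λ x y → :- (x :* (:- y)) := x :* y) refl x y)
    (0≤y-x⇒x≤y (subst (0# ≤_) (solve 2 (λ x y → x :* (:- y) := con (ℤ.+ 0) :- (:- (x :* (:- y)))) refl x y)
      (*-nonneg 0≤x (0≤-⁺ y≤0))))

  0≤1 : 0# ≤ 1#
  0≤1 = [ id , (λ 1≤0 → subst (0# ≤_) (solve 0 (:- con (ℤ.+ 1) :* :- con (ℤ.+ 1) := con (ℤ.+ 1)) refl)
                          (*-nonneg (0≤-⁺ 1≤0) (0≤-⁺ 1≤0))) ]′ (total 0# 1#)

  0<1 : 0# < 1#
  0<1 = ≤∧≢⇒< 0≤1 0≢1

  ι-nonneg : ∀ n → 0# ≤ n ×ₙ 1#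
  ι-nonneg zero    = ≤-refl
  ι-nonneg (suc n) = subst (0# ≤_) (sym (1+× n 1#)) (+-nonneg 0≤1 (ι-nonneg n))

  ι-pos : ∀ n → 0# < suc n ×ₙ 1#
  ι-pos n = subst (0# <_) (sym (1+× n 1#)) (+-pos-nonneg 0<1 (ι-nonneg n))

  ι-- : ∀ m n → ι (m ℤ.- n) ≡ ι m - ι n
  ι-- m n = trans (ι-+ m (ℤ.- n)) (cong (ι m +_) (ι-neg n))

  ι-mono-≤ : ∀ {m n} → m ℤ.≤ n → ι m ≤ ι n
  ι-mono-≤ {m} {n} m≤n with n ℤ.- m in eq | ℤ.i≤j⇒0≤j-i m≤n
  ... | ℤ.+ k | _ = 0≤y-x⇒x≤y (subst (0# ≤_) (trans (cong ι (sym eq)) (ι-- n m)) (ι-nonneg k))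

  -- A positive difference of integers embeds as a positive element. Together with `ι-mono-≤` this
  -- carries integer computations about halfplanes over to `R`, in both directions.
  ι-cancel-≤ : ∀ {m n} → ι m ≤ ι n → m ℤ.≤ n
  ι-cancel-≤ {m} {n} ιm≤ιn with m ℤ.- n in eq
  ... | -[1+ k ] = ℤ.i-j≤0⇒i≤j (subst (ℤ._≤ ℤ.+ 0) (sym eq) ℤ.-≤+)
  ... | ℤ.+ zero   = ℤ.i-j≤0⇒i≤j (subst (ℤ._≤ ℤ.+ 0) (sym eq) ℤ.≤-refl)
  ... | ℤ.+ suc k  = contradiction ιm≤ιn
    (0<y-x⇒x<y (subst (0# <_) (trans (cong ι (sym eq)) (ι-- m n)) (ι-pos k)))

  ι-injective : ∀ {m n} → ι m ≡ ι n → m ≡ n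
  ι-injective ιm≡ιn = ℤ.≤-antisym (ι-cancel-≤ (≤-reflexive ιm≡ιn)) (ι-cancel-≤ (≤-reflexive (sym ιm≡ιn)))

-- Delaunay-edges as pairs of extreme points, and sweeping towards the normal of a halfplane.

module Geometry (R : RealField) where
  open OrderedField R
  open RingSolver using (solve; _:=_; _:+_; _:*_; _:-_; :-_; con)
  open Plane R

  infix 4 _≟P_
  _≟P_ : DecidableEquality Point
  _≟P_ = ≡-dec _≟_ _≟_

  dot cross : Point → Point → Carrier
  dot (a , b) (x , y)   = a * x + b * y
  cross (a , b) (c , d) = a * d - b * c

  _∈H?_ : Decidable _∈H_
  (x , y) ∈H? halfplane a b c _ = c ≤? (a * x + b * y)

  -- What is left of a Delaunay-edge when the offset of its halfplane is forgotten: a condition on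
  -- the direction `d` alone, by which edges can be arranged around the circle. The order of `p` and
  -- `q` between themselves stays open.
  record TopTwo (S : List Point) (d p q : Point) : Set where
    constructor topTwo
    field
      distinct : p ≢ q
      p∈S      : p ∈ S
      q∈S      : q ∈ S
      beats    : ∀ {r} → r ∈ S → r ≢ p → r ≢ q → dot d r < dot d p × dot d r < dot d q

  module _ {S : List Point} {d : Point} where

    TopTwo-sym : ∀ {p q} → TopTwo S d p q → TopTwo S d q p
    TopTwo-sym (topTwo p≢q p∈S q∈S beats) =
      topTwo (p≢q ∘ sym) q∈S p∈S λ r∈S r≢q r≢p → let (<p , <q) = beats r∈S r≢p r≢q in <q , <p

    -- Otherwise p and q both beat r, so that each of them must be s.
    endpoint : ∀ {p q r s} → TopTwo S d p q → TopTwo S d r s → r ≡ p ⊎ r ≡ q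
    endpoint {p} {q} {r} {s} E E′ = decidable-stable (r ≟P p ⊎-dec r ≟P q) λ r∉E →
      let module E = TopTwo E
          module E′ = TopTwo E′
          r≢p = r∉E ∘ inj₁
          r≢q = r∉E ∘ inj₂
          (r<p , r<q) = E.beats E′.p∈S r≢p r≢q
          ≡s : ∀ {z} → z ∈ S → r ≢ z → dot d r < dot d z → z ≡ s
          ≡s {z} z∈S r≢z r<z = decidable-stable (z ≟P s) λ z≢s →
            <⇒≱ r<z (proj₁ (E′.beats z∈S (r≢z ∘ sym) z≢s))
      in E.distinct (trans (≡s E.p∈S r≢p r<p) (sym (≡s E.q∈S r≢q r<q)))
      where
      <⇒≱ : ∀ {x y} → x < y → ¬ y < x
      <⇒≱ x<y y<x = <-irrefl (<-trans x<y y<x)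

    TopTwo-unique : ∀ {p q r s} → TopTwo S d p q → TopTwo S d r s → SameEdge p q r s
    TopTwo-unique E E′ with endpoint E′ E | endpoint E′ (TopTwo-sym E)
    ... | inj₁ p≡r | inj₂ q≡s = inj₁ (p≡r , q≡s)
    ... | inj₂ p≡s | inj₁ q≡r = inj₂ (p≡s , q≡r)
    ... | inj₁ p≡r | inj₁ q≡r = contradiction (trans p≡r (sym q≡r)) (TopTwo.distinct E)
    ... | inj₂ p≡s | inj₂ q≡s = contradiction (trans p≡s (sym q≡s)) (TopTwo.distinct E)

  -- The offset of the halfplane is the smaller of the two values `dot d p` and `dot d q`.
  TopTwo⇒DelaunayEdge : ∀ {S d p q} → ¬ (proj₁ d ≡ 0# × proj₂ d ≡ 0#) → TopTwo S d p q → DelaunayEdge S p q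
  TopTwo⇒DelaunayEdge {S} {d@(a , b)} {p} {q} d≢0 E@(topTwo p≢q p∈S q∈S beats) =
    [ (λ p≤q → p≢q , p∈S , q∈S , halfplane a b (dot d p) d≢0 , cut E p≤q)
    , (λ q≤p → p≢q , p∈S , q∈S , halfplane a b (dot d q) d≢0 ,
        λ r r∈S → let open Equivalence (cut (TopTwo-sym E) q≤p r r∈S) in
          mk⇔ (Sum.swap ∘ to) (from ∘ Sum.swap))
    ]′ (total (dot d p) (dot d q))
    where
    cut : ∀ {p q} → TopTwo S d p q → dot d p ≤ dot d q →
          ∀ r → r ∈ S → dot d p ≤ dot d r ⇔ (r ≡ p ⊎ r ≡ q)
    cut {p} {q} E p≤q r r∈S = mk⇔
      (λ p≤r → decidable-stable (r ≟P p ⊎-dec r ≟P q) λ r∉E →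
        proj₁ (TopTwo.beats E r∈S (r∉E ∘ inj₁) (r∉E ∘ inj₂)) p≤r)
      (λ { (inj₁ refl) → ≤-refl ; (inj₂ refl) → p≤q })

  DelaunayEdge⇒TopTwo : ∀ {S p q} → DelaunayEdge S p q →
    ∃[ d ] (¬ (proj₁ d ≡ 0# × proj₂ d ≡ 0#) × TopTwo S d p q)
  DelaunayEdge⇒TopTwo {S} {p} {q} (p≢q , p∈S , q∈S , halfplane a b c d≢0 , cut) =
    (a , b) , d≢0 , topTwo p≢q p∈S q∈S λ {r} r∈S r≢p r≢q →
      let r<c : dot (a , b) r < c
          r<c = λ c≤r → [ r≢p , r≢q ]′ (Equivalence.to (cut r r∈S) c≤r)
      in <-≤-trans r<c (Equivalence.from (cut p p∈S) (inj₁ refl))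
       , <-≤-trans r<c (Equivalence.from (cut q q∈S) (inj₂ refl))

  normal : Halfplane → Point
  normal (halfplane a b _ _) = a , b

  Inside : List Point → Halfplane → Point → Set
  Inside S H d = ∃[ p ] ∃[ q ] (TopTwo S d p q × p ∈H H × q ∈H H)

  -- By `TopTwo-unique` this differs from `Inside` only in directions that have no top two. The
  -- universal form permits conclusions about a direction without first producing an edge there.
  AllInside : List Point → Halfplane → Point → Set
  AllInside S H d = ∀ {p q} → TopTwo S d p q → p ∈H H × q ∈H H

  module _ {S : List Point} {H : Halfplane} where
    private
      u = normal H

    -- κ may vanish: then v is opposite to u, and no point of S lies outside H.
    cone : ∀ {v x κ α β} → 0# ≤ κ → 0# < α → 0# ≤ β →
           (∀ z → κ * dot x z ≡ α * dot u z + β * dot v z) →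
           Inside S H v → AllInside S H x
    cone {v} {x} {κ} {α} {β} 0≤κ 0<α 0≤β comb (p , q , E , p∈H , q∈H) E′ =
      inside E′ , inside (TopTwo-sym E′)
      where
      inside : ∀ {r s} → TopTwo S x r s → r ∈H H
      inside {r} {s} E′ = decidable-stable (r ∈H? H) outside
        where
        open TopTwo
        outside : ¬ ¬ r ∈H H
        -- Both `p` and `q` beat `r` in direction `u`, since `r` alone of the three is outside `H`,
        -- and in direction `v` by `E`; hence they beat it in direction `x`. But there every point
        -- other than `r` and `s` loses to `r`, so both would be `s`.
        outside r∉H = distinct E
          (trans (≡s (p∈S E) p∈H (proj₁ v-beats)) (sym (≡s (q∈S E) q∈H (proj₂ v-beats))))
          where
          ≢r : ∀ {z} → z ∈H H → r ≢ z
          ≢r z∈H refl = r∉H z∈H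
          v-beats : dot v r < dot v p × dot v r < dot v q
          v-beats = beats E (p∈S E′) (≢r p∈H) (≢r q∈H)
          ≡s : ∀ {z} → z ∈ S → z ∈H H → dot v r < dot v z → z ≡ s
          ≡s {z} z∈S z∈H vr<vz = decidable-stable (z ≟P s) λ z≢s →
            <-irrefl (<-trans x-beats (proj₁ (beats E′ z∈S (≢r z∈H ∘ sym) z≢s)))
            where
            x-beats : dot x r < dot x z
            x-beats = 0<y-x⇒x<y $ *-cancel-pos 0≤κ $ subst (0# <_) identity $
              +-pos-nonneg (*-pos 0<α (x<y⇒0<y-x (<-≤-trans r∉H z∈H)))
                           (*-nonneg 0≤β (x≤y⇒0≤y-x (<⇒≤ vr<vz)))
              where
              open ≡-Reasoning
              identity : α * (dot u z - dot u r) + β * (dot v z - dot v r) ≡ κ * (dot x z - dot x r)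
              identity = begin
                α * (dot u z - dot u r) + β * (dot v z - dot v r)
                  ≡⟨ solve 6 (λ α β uz ur vz vr → α :* (uz :- ur) :+ β :* (vz :- vr) :=
                       (α :* uz :+ β :* vz) :- (α :* ur :+ β :* vr))
                       refl α β (dot u z) (dot u r) (dot v z) (dot v r) ⟩
                α * dot u z + β * dot v z - (α * dot u r + β * dot v r)
                  ≡⟨ sym (cong₂ _-_ (comb z) (comb r)) ⟩
                κ * dot x z - κ * dot x r
                  ≡⟨ solve 3 (λ κ xz xr → κ :* xz :- κ :* xr := κ :* (xz :- xr)) refl κ (dot x z) (dot x r) ⟩
                κ * (dot x z - dot x r) ∎

    -- The signs say that x lies on the shorter arc from v to u.  The coefficients are those of
    -- cross v u * x = cross v x * u + cross x u * v.
    sweep↻ : ∀ {v x} → 0# ≤ cross v u → 0# < cross v x → 0# ≤ cross x u → Inside S H v → AllInside S H x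
    sweep↻ {a , b} {c , d} 0≤vu 0<vx 0≤xu = cone 0≤vu 0<vx 0≤xu λ (z , w) →
      solve 8 (λ a b c d e f z w →
        (a :* f :- b :* e) :* (c :* z :+ d :* w) :=
        (a :* d :- b :* c) :* (e :* z :+ f :* w) :+ (c :* f :- d :* e) :* (a :* z :+ b :* w))
        refl a b c d (proj₁ u) (proj₂ u) z w

    sweep↺ : ∀ {v x} → 0# ≤ cross u v → 0# < cross x v → 0# ≤ cross u x → Inside S H v → AllInside S H x
    sweep↺ {a , b} {c , d} 0≤uv 0<xv 0≤ux = cone 0≤uv 0<xv 0≤ux λ (z , w) →
      solve 8 (λ a b c d e f z w →
        (e :* b :- f :* a) :* (c :* z :+ d :* w) :=
        (c :* b :- d :* a) :* (e :* z :+ f :* w) :+ (e :* d :- f :* c) :* (a :* z :+ b :* w))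
        refl a b c d (proj₁ u) (proj₂ u) z w

  -- Directions in clockwise order, and the crossing lemma.

  Direction : Set
  Direction = Carrier ⊎ Carrier

  -- Every nonhorizontal direction is, up to a positive factor, (t , 1) or its opposite.
  vec : Direction → Point
  vec (inj₁ t) = t , 1#
  vec (inj₂ t) = - t , - 1#

  vec≢0 : ∀ d → ¬ (proj₁ (vec d) ≡ 0# × proj₂ (vec d) ≡ 0#)
  vec≢0 (inj₁ t) (_ , 1≡0)  = 0≢1 (sym 1≡0)
  vec≢0 (inj₂ t) (_ , -1≡0) = 0≢1 (sym (trans
    (solve 0 (con (ℤ.+ 1) := :- (:- con (ℤ.+ 1))) refl)
    (trans (cong -_ -1≡0) (solve 0 (:- con (ℤ.+ 0) := con (ℤ.+ 0)) refl))))

  -- With this parametrisation both halves, and hence the sum order, run clockwise.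
  infix 4 _≺_
  _≺_ : Direction → Direction → Set
  _≺_ = _<_ ⊎-< _<_

  module _ {S : List Point} {H : Halfplane} where
    private
      a = Halfplane.a H
      b = Halfplane.b H
      u : Point
      u = a , b

      -- The cross product of (t , 1) with the normal of H.
      γ : Carrier → Carrier
      γ t = b * t - a

      I J : Direction → Set
      I d = Inside S H (vec d)
      J d = AllInside S H (vec d)

      -- The letters name the arguments of `cross` in order: `u` is the normal of `H`, `U` a
      -- direction of the upper half, `L` one of the lower half.
      Uu : ∀ s → γ s ≡ cross (vec (inj₁ s)) u
      Uu s = solve 3 (λ a b s → b :* s :- a := s :* b :- con (ℤ.+ 1) :* a) refl a b s
      uU : ∀ s → - γ s ≡ cross u (vec (inj₁ s))
      uU s = solve 3 (λ a b s → :- (b :* s :- a) := a :* con (ℤ.+ 1) :- b :* s) refl a b s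
      Lu : ∀ s → - γ s ≡ cross (vec (inj₂ s)) u
      Lu s = solve 3 (λ a b s → :- (b :* s :- a) := (:- s) :* b :- (:- con (ℤ.+ 1)) :* a) refl a b s
      uL : ∀ s → γ s ≡ cross u (vec (inj₂ s))
      uL s = solve 3 (λ a b s → b :* s :- a := a :* (:- con (ℤ.+ 1)) :- b :* (:- s)) refl a b s

      UU : ∀ s t → s - t ≡ cross (vec (inj₁ s)) (vec (inj₁ t))
      UU s t = solve 2 (λ s t → s :- t := s :* con (ℤ.+ 1) :- con (ℤ.+ 1) :* t) refl s t
      UL : ∀ s t → t - s ≡ cross (vec (inj₁ s)) (vec (inj₂ t))
      UL s t = solve 2 (λ s t → t :- s := s :* (:- con (ℤ.+ 1)) :- con (ℤ.+ 1) :* (:- t)) refl s t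
      LU : ∀ s t → t - s ≡ cross (vec (inj₂ s)) (vec (inj₁ t))
      LU s t = solve 2 (λ s t → t :- s := (:- s) :* con (ℤ.+ 1) :- (:- con (ℤ.+ 1)) :* t) refl s t
      LL : ∀ s t → s - t ≡ cross (vec (inj₂ s)) (vec (inj₂ t))
      LL s t = solve 2 (λ s t → s :- t := (:- s) :* (:- con (ℤ.+ 1)) :- (:- con (ℤ.+ 1)) :* (:- t)) refl s t

      nonneg : ∀ {x y} → x ≡ y → 0# ≤ x → 0# ≤ y
      nonneg = subst (0# ≤_)
      nonpos : ∀ {x y} → - x ≡ y → x ≤ 0# → 0# ≤ y
      nonpos eq x≤0 = subst (0# ≤_) eq (0≤-⁺ x≤0)
      pos : ∀ {x y z} → y - x ≡ z → x < y → 0# < z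
      pos eq x<y = subst (0# <_) eq (x<y⇒0<y-x x<y)

      -- U and L are the upper (inj₁) and lower (inj₂) half; an arrow tells in which way the slope
      -- changes from s to t.
      module _ {s t : Carrier} where
        UU↓ : t < s → 0# ≤ γ s → 0# ≤ γ t → I (inj₁ s) → J (inj₁ t)
        UU↓ t<s γs γt = sweep↻ {H = H} (nonneg (Uu s) γs) (pos (UU s t) t<s) (nonneg (Uu t) γt)
        UU↑ : s < t → γ s ≤ 0# → γ t ≤ 0# → I (inj₁ s) → J (inj₁ t)
        UU↑ s<t γs γt = sweep↺ {H = H} (nonpos (uU s) γs) (pos (UU t s) s<t) (nonpos (uU t) γt)
        LL↑ : s < t → 0# ≤ γ s → 0# ≤ γ t → I (inj₂ s) → J (inj₂ t)
        LL↑ s<t γs γt = sweep↺ {H = H} (nonneg (uL s) γs) (pos (LL t s) s<t) (nonneg (uL t) γt)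
        LL↓ : t < s → γ s ≤ 0# → γ t ≤ 0# → I (inj₂ s) → J (inj₂ t)
        LL↓ t<s γs γt = sweep↻ {H = H} (nonpos (Lu s) γs) (pos (LL s t) t<s) (nonpos (Lu t) γt)
        UL↑ : s < t → 0# ≤ γ s → γ t ≤ 0# → I (inj₁ s) → J (inj₂ t)
        UL↑ s<t γs γt = sweep↻ {H = H} (nonneg (Uu s) γs) (pos (UL s t) s<t) (nonpos (Lu t) γt)
        UL↓ : t < s → γ s ≤ 0# → 0# ≤ γ t → I (inj₁ s) → J (inj₂ t)
        UL↓ t<s γs γt = sweep↺ {H = H} (nonpos (uU s) γs) (pos (LU t s) t<s) (nonneg (uL t) γt)
        LU↑ : s < t → γ s ≤ 0# → 0# ≤ γ t → I (inj₂ s) → J (inj₁ t)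
        LU↑ s<t γs γt = sweep↻ {H = H} (nonpos (Lu s) γs) (pos (LU s t) s<t) (nonneg (Uu t) γt)

      sign : ∀ t → 0# ≤ γ t ⊎ γ t < 0#
      sign t with 0# ≤? (γ t)
      ... | yes 0≤γt = inj₁ 0≤γt
      ... | no  γt<0 = inj₂ γt<0

      γ-diff : ∀ s t → b * (t - s) ≡ γ t - γ s
      γ-diff s t = solve 4 (λ a b s t → b :* (t :- s) := b :* t :- a :- (b :* s :- a)) refl a b s t

      γ-mono : 0# ≤ b → ∀ {s t} → s ≤ t → γ s ≤ γ t
      γ-mono 0≤b {s} {t} s≤t = 0≤y-x⇒x≤y (subst (0# ≤_) (γ-diff s t) (*-nonneg 0≤b (x≤y⇒0≤y-x s≤t)))

      γ-anti : b ≤ 0# → ∀ {s t} → s ≤ t → γ t ≤ γ s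
      γ-anti b≤0 {s} {t} s≤t = 0≤y-x⇒x≤y (subst (0# ≤_)
        (trans (solve 3 (λ b s t → (:- b) :* (t :- s) := b :* (s :- t)) refl b s t) (γ-diff t s))
        (*-nonneg (0≤-⁺ b≤0) (x≤y⇒0≤y-x s≤t)))

      module Increasing (mono : ∀ {s t} → s ≤ t → γ s ≤ γ t) where
        <⇐γ : ∀ {s t} → γ s < γ t → s < t
        <⇐γ γs<γt t≤s = γs<γt (mono t≤s)

        -- If `0# < b`, the upper half contains the direction of `u` and the lower half its
        -- opposite, both at the slope where `γ` vanishes; the sign of `γ` tells on which side of
        -- them a direction lies. If `b` is zero, both are horizontal and `γ` is constant.
        crossing : ∀ {v x w y} → v ≺ x → x ≺ w → w ≺ y → I v → I w → J x ⊎ J y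
        -- The arc from `v` to `w` through `x` stays in the upper half and so avoids the opposite of
        -- `u`: `x` is passed on the way to `u` from `v` or from `w`.
        crossing {x = inj₁ x} (₁∼₁ v<x) (₁∼₁ x<w) _ Iv Iw with sign x
        ... | inj₁ 0≤γx = inj₁ (UU↓ x<w (≤-trans 0≤γx (mono (<⇒≤ x<w))) 0≤γx Iw)
        ... | inj₂ γx<0 = inj₁ (UU↑ v<x (≤-trans (mono (<⇒≤ v<x)) (<⇒≤ γx<0)) (<⇒≤ γx<0) Iv)
        -- Moving from `w` away from the opposite of `u` leads to `y` if `w` is already past that
        -- opposite, and to `x` if not.
        crossing {w = inj₂ w} _ (₂∼₂ x<w) (₂∼₂ w<y) Iv Iw with sign w
        ... | inj₁ 0≤γw = inj₂ (LL↑ w<y 0≤γw (≤-trans 0≤γw (mono (<⇒≤ w<y))) Iw)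
        ... | inj₂ γw<0 = inj₁ (LL↓ x<w (<⇒≤ γw<0) (≤-trans (mono (<⇒≤ x<w)) (<⇒≤ γw<0)) Iw)
        crossing {x = inj₁ x} {inj₂ w} (₁∼₁ v<x) ₁∼₂ (₂∼₂ w<y) Iv Iw with sign x | sign w
        ... | inj₂ γx<0 | _ = inj₁ (UU↑ v<x (≤-trans (mono (<⇒≤ v<x)) (<⇒≤ γx<0)) (<⇒≤ γx<0) Iv)
        ... | inj₁ _    | inj₁ 0≤γw = inj₂ (LL↑ w<y 0≤γw (≤-trans 0≤γw (mono (<⇒≤ w<y))) Iw)
        ... | inj₁ 0≤γx | inj₂ γw<0 = inj₁ (LU↑ (<⇐γ (<-≤-trans γw<0 0≤γx)) (<⇒≤ γw<0) 0≤γx Iw)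

      module Decreasing (anti : ∀ {s t} → s ≤ t → γ t ≤ γ s) where
        <⇐γ : ∀ {s t} → γ t < γ s → s < t
        <⇐γ γt<γs t≤s = γt<γs (anti t≤s)

        -- The halves exchange their roles: for `b < 0#` the opposite of `u` is in the upper half
        -- and `u` in the lower one, and nonnegative `γ` means not yet past them. A sweep from `v`
        -- to `y` may now run across the cut of the cycle.
        crossing : ∀ {v x w y} → v ≺ x → x ≺ w → w ≺ y → I v → I w → J x ⊎ J y
        crossing {w = inj₁ w} _ (₁∼₁ x<w) (₁∼₁ w<y) Iv Iw with sign w
        ... | inj₁ 0≤γw = inj₁ (UU↓ x<w 0≤γw (≤-trans 0≤γw (anti (<⇒≤ x<w))) Iw)
        ... | inj₂ γw<0 = inj₂ (UU↑ w<y (<⇒≤ γw<0) (≤-trans (anti (<⇒≤ w<y)) (<⇒≤ γw<0)) Iw)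
        crossing {x = inj₂ x} (₂∼₂ v<x) (₂∼₂ x<w) _ Iv Iw with sign x
        ... | inj₁ 0≤γx = inj₁ (LL↑ v<x (≤-trans 0≤γx (anti (<⇒≤ v<x))) 0≤γx Iv)
        ... | inj₂ γx<0 = inj₁ (LL↓ x<w (≤-trans (anti (<⇒≤ x<w)) (<⇒≤ γx<0)) (<⇒≤ γx<0) Iw)
        -- Unless `x` is reached within the upper half, the opposite of `u` separates `v` from `w`;
        -- then `y` is reached from `w` if it is not past `u`, and from `v` if it is.
        crossing {inj₁ v} {inj₁ x} {inj₁ w} {inj₂ y} (₁∼₁ v<x) (₁∼₁ x<w) ₁∼₂ Iv Iw
          with sign x | sign y | sign v | sign w
        ... | inj₁ 0≤γx | _         | _         | inj₁ 0≤γw = inj₁ (UU↓ x<w 0≤γw 0≤γx Iw)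
        ... | inj₁ _    | inj₁ 0≤γy | _         | inj₂ γw<0 =
              inj₂ (UL↓ (<⇐γ (<-≤-trans γw<0 0≤γy)) (<⇒≤ γw<0) 0≤γy Iw)
        ... | inj₁ 0≤γx | inj₂ γy<0 | _         | inj₂ _    =
              let 0≤γv = ≤-trans 0≤γx (anti (<⇒≤ v<x)) in
              inj₂ (UL↑ (<⇐γ (<-≤-trans γy<0 0≤γv)) 0≤γv (<⇒≤ γy<0) Iv)
        ... | inj₂ γx<0 | _         | inj₂ γv<0 | _         = inj₁ (UU↑ v<x (<⇒≤ γv<0) (<⇒≤ γx<0) Iv)
        ... | inj₂ _    | inj₂ γy<0 | inj₁ 0≤γv | _         =
              inj₂ (UL↑ (<⇐γ (<-≤-trans γy<0 0≤γv)) 0≤γv (<⇒≤ γy<0) Iv)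
        ... | inj₂ γx<0 | inj₁ 0≤γy | inj₁ _    | _         =
              let γw<0 = ≤-<-trans (anti (<⇒≤ x<w)) γx<0 in
              inj₂ (UL↓ (<⇐γ (<-≤-trans γw<0 0≤γy)) (<⇒≤ γw<0) 0≤γy Iw)
        crossing {inj₁ v} {inj₂ x} {inj₂ w} {inj₂ y} ₁∼₂ (₂∼₂ x<w) (₂∼₂ w<y) Iv Iw
          with sign x | sign y | sign v | sign w
        ... | _         | inj₁ 0≤γy | _         | inj₁ 0≤γw = inj₂ (LL↑ w<y 0≤γw 0≤γy Iw)
        ... | inj₂ γx<0 | _         | _         | inj₂ γw<0 = inj₁ (LL↓ x<w (<⇒≤ γw<0) (<⇒≤ γx<0) Iw)
        ... | _         | inj₂ γy<0 | inj₁ 0≤γv | _         =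
              inj₂ (UL↑ (<⇐γ (<-≤-trans γy<0 0≤γv)) 0≤γv (<⇒≤ γy<0) Iv)
        ... | inj₁ 0≤γx | _         | inj₂ γv<0 | _         =
              inj₁ (UL↓ (<⇐γ (<-≤-trans γv<0 0≤γx)) (<⇒≤ γv<0) 0≤γx Iv)
        ... | inj₂ γx<0 | _         | _         | inj₁ 0≤γw =
              contradiction (≤-trans 0≤γw (anti (<⇒≤ x<w))) γx<0
        ... | _         | inj₁ 0≤γy | _         | inj₂ γw<0 =
              contradiction (≤-trans 0≤γy (anti (<⇒≤ w<y))) γw<0
        crossing {inj₁ v} {inj₁ x} {inj₂ w} {inj₂ y} (₁∼₁ v<x) ₁∼₂ (₂∼₂ w<y) Iv Iw with sign v | sign y
        ... | inj₂ γv<0 | _         = inj₁ (UU↑ v<x (<⇒≤ γv<0) (≤-trans (anti (<⇒≤ v<x)) (<⇒≤ γv<0)) Iv)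
        ... | inj₁ 0≤γv | inj₂ γy<0 = inj₂ (UL↑ (<⇐γ (<-≤-trans γy<0 0≤γv)) 0≤γv (<⇒≤ γy<0) Iv)
        ... | inj₁ _    | inj₁ 0≤γy = inj₂ (LL↑ w<y (≤-trans 0≤γy (anti (<⇒≤ w<y))) 0≤γy Iw)

    -- v and w cut the circle into two arcs, one through x and one through y.  All edges with directions
    -- on the arc that avoids the opposite of u are inside H.
    crossing : ∀ {v x w y} → v ≺ x → x ≺ w → w ≺ y → I v → I w → J x ⊎ J y
    crossing with total 0# b
    ... | inj₁ 0≤b = Increasing.crossing (γ-mono 0≤b)
    ... | inj₂ b≤0 = Decreasing.crossing (γ-anti b≤0)

-- Linear inequalities in one unknown, and the decision whether a pair is extreme in some direction.

extremum : ∀ {A : Set} {_⊑_ : Rel A 0ℓ} → Reflexive _⊑_ → Transitive _⊑_ → Total _⊑_ →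
  ∀ x xs → ∃[ m ] (m ∈ x ∷ xs × All (_⊑ m) (x ∷ xs))
extremum ⊑-refl ⊑-trans total x [] = x , here refl , ⊑-refl ∷ []
extremum ⊑-refl ⊑-trans total x (y ∷ ys) with extremum ⊑-refl ⊑-trans total y ys
... | m , m∈ , ⊑m with total x m
...   | inj₁ x⊑m = m , there m∈ , x⊑m ∷ ⊑m
...   | inj₂ m⊑x = x , here refl , ⊑-refl ∷ All.map (λ z⊑m → ⊑-trans z⊑m m⊑x) ⊑m

module DelaunayEdges (R : RealField) where
  open OrderedField R
  open RingSolver using (solve; _:=_; _:+_; _:*_; _:-_; :-_; con)
  open Plane R
  open Geometry R

  greatest : ∀ x xs → ∃[ m ] (m ∈ x ∷ xs × All (_≤ m) (x ∷ xs))
  greatest = extremum ≤-refl ≤-trans total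

  least : ∀ x xs → ∃[ m ] (m ∈ x ∷ xs × All (m ≤_) (x ∷ xs))
  least = extremum ≤-refl (flip ≤-trans) (flip total)

  x<x+1 : ∀ x → x < x + 1#
  x<x+1 x = 0<y-x⇒x<y (subst (0# <_) (solve 1 (λ x → con (ℤ.+ 1) := x :+ con (ℤ.+ 1) :- x) refl x) 0<1)

  x-1<x : ∀ x → x - 1# < x
  x-1<x x = 0<y-x⇒x<y (subst (0# <_) (solve 1 (λ x → con (ℤ.+ 1) := x :- (x :- con (ℤ.+ 1))) refl x) 0<1)

  dense : ∀ {x y} → x < y → ∃[ t ] (x < t × t < y)
  -- The midpoint: `h` is one half.
  dense {x} {y} x<y = x + h * (y - x)
    , 0<y-x⇒x<y (subst (0# <_)
        (solve 3 (λ x y h → h :* (y :- x) := x :+ h :* (y :- x) :- x) refl x y h) 0<step)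
    , 0<y-x⇒x<y (subst (0# <_) upper 0<step)
    where
    open ≡-Reasoning
    2# = 1# + 1#
    0<2 : 0# < 2#
    0<2 = +-pos-nonneg 0<1 0≤1
    half = inverse 2# λ 2≡0 → 0<2 (≤-reflexive 2≡0)
    h = proj₁ half
    0<step : 0# < h * (y - x)
    0<step = *-pos (*-cancel-pos (<⇒≤ 0<2) (subst (0# <_) (sym (proj₂ half)) 0<1)) (x<y⇒0<y-x x<y)
    upper : h * (y - x) ≡ y - (x + h * (y - x))
    upper = begin
      h * (y - x)
        ≡⟨ solve 3 (λ x y h → h :* (y :- x) :=
             (con (ℤ.+ 1) :+ con (ℤ.+ 1)) :* h :* (y :- x) :- h :* (y :- x)) refl x y h ⟩
      2# * h * (y - x) - h * (y - x)
        ≡⟨ cong (λ k → k * (y - x) - h * (y - x)) (proj₂ half) ⟩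
      1# * (y - x) - h * (y - x)
        ≡⟨ solve 3 (λ x y h → con (ℤ.+ 1) :* (y :- x) :- h :* (y :- x) :=
             y :- (x :+ h :* (y :- x))) refl x y h ⟩
      y - (x + h * (y - x)) ∎

  -- Only the greatest lower bound and the least upper bound matter, and density separates them. If
  -- one side is empty, a step of `1#` beyond the extreme bound of the other side suffices.
  between : ∀ ls hs → All (λ l → All (l <_) hs) ls → ∃[ t ] (All (_< t) ls × All (t <_) hs)
  between []       []       _ = 0# , [] , []
  between []       (h ∷ hs) _ =
    let (m , _ , m≤) = least h hs in m - 1# , [] , All.map (<-≤-trans (x-1<x m)) m≤
  between (l ∷ ls) []       _ =
    let (m , _ , ≤m) = greatest l ls in m + 1# , All.map (λ l≤m → ≤-<-trans l≤m (x<x+1 m)) ≤m , []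
  between (l ∷ ls) (h ∷ hs) l<h =
    let (m , m∈ , ≤m) = greatest l ls
        (n , n∈ , n≤) = least h hs
        (t , m<t , t<n) = dense (All.lookup (All.lookup l<h m∈) n∈)
    in t , All.map (λ l≤m → ≤-<-trans l≤m m<t) ≤m , All.map (<-≤-trans t<n) n≤

  between? : ∀ ls hs → Dec (∃[ t ] (All (_< t) ls × All (t <_) hs))
  between? ls hs = map′ (between ls hs)
    (λ (t , ls<t , t<hs) → All.map (λ l<t → All.map (<-trans l<t) t<hs) ls<t)
    (All.all? (λ l → All.all? (l <?_) hs) ls)

  Positive : Point → Point → Set
  Positive d v = 0# < dot d v

  -- For fixed `v`, positivity is a strict linear inequality in `t`: it describes an open half-line,
  -- or, if the first coordinate of `v` is zero, a condition free of `t`.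
  data Ray (v : Point) : Set where
    above : ∀ l → (∀ t → Positive (t , 1#) v ⇔ l < t) → Ray v
    below : ∀ h → (∀ t → Positive (t , 1#) v ⇔ t < h) → Ray v
    level : ∀ b → (∀ t → Positive (t , 1#) v ⇔ 0# < b) → Ray v

  solution : ∀ {a} → a ≢ 0# → ∀ b → ∃[ t ] (a * t ≡ b)
  solution {a} a≢0 b with inverse a a≢0
  ... | a⁻¹ , aa⁻¹≡1 = a⁻¹ * b , trans (sym (*-assoc a a⁻¹ b)) (trans (cong (_* b) aa⁻¹≡1) (*-identityˡ b))

  *-pos⇔ : ∀ {k x y z} → 0# < k → k * (y - x) ≡ z → (0# < z) ⇔ (x < y)
  *-pos⇔ 0<k refl = mk⇔ (0<y-x⇒x<y ∘ *-cancel-pos (<⇒≤ 0<k)) (*-pos 0<k ∘ x<y⇒0<y-x)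

  rising : ∀ {a} → 0# < a → ∀ b → ∃[ l ] (∀ t → Positive (t , 1#) (a , b) ⇔ l < t)
  rising {a} 0<a b with solution (λ { refl → <-irrefl 0<a }) (- b)
  ... | l , al≡-b = l , λ t → *-pos⇔ 0<a $ begin
    a * (t - l)           ≡⟨ solve 3 (λ a t l → a :* (t :- l) := t :* a :- a :* l) refl a t l ⟩
    t * a - a * l         ≡⟨ cong (λ k → t * a - k) al≡-b ⟩
    t * a - - b           ≡⟨ solve 3 (λ a t b → t :* a :- (:- b) := t :* a :+ con (ℤ.+ 1) :* b) refl a t b ⟩
    t * a + 1# * b        ∎
    where open ≡-Reasoning

  falling : ∀ {a} → a < 0# → ∀ b → ∃[ h ] (∀ t → Positive (t , 1#) (a , b) ⇔ t < h)
  falling {a} a<0 b with solution (λ { refl → <-irrefl a<0 }) (- b)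
  ... | h , ah≡-b = h , λ t → *-pos⇔ (0<-⁺ a<0) $ begin
    - a * (h - t)         ≡⟨ solve 3 (λ a t h → (:- a) :* (h :- t) := t :* a :- a :* h) refl a t h ⟩
    t * a - a * h         ≡⟨ cong (λ k → t * a - k) ah≡-b ⟩
    t * a - - b           ≡⟨ solve 3 (λ a t b → t :* a :- (:- b) := t :* a :+ con (ℤ.+ 1) :* b) refl a t b ⟩
    t * a + 1# * b        ∎
    where open ≡-Reasoning

  data Sign (x : Carrier) : Set where
    positive : 0# < x → Sign x
    null     : x ≡ 0# → Sign x
    negative : x < 0# → Sign x

  sign : ∀ x → Sign x
  sign x with 0# <? x | x <? 0#
  ... | yes 0<x | _       = positive 0<x
  ... | no _    | yes x<0 = negative x<0
  ... | no 0≮x  | no x≮0  = null (antisym (decidable-stable (x ≤? 0#) 0≮x) (decidable-stable (0# ≤? x) x≮0))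

  ray : ∀ v → Ray v
  ray (a , b) with sign a
  ... | positive 0<a = uncurry above (rising 0<a b)
  ... | negative a<0 = uncurry below (falling a<0 b)
  ... | null refl    = level b λ t →
        let eq = solve 2 (λ t b → t :* con (ℤ.+ 0) :+ con (ℤ.+ 1) :* b := b) refl t b in
        mk⇔ (subst (0# <_) eq) (subst (0# <_) (sym eq))

  -- Fourier-Motzkin elimination of a single unknown: each vector adds a lower bound to `ls`, an
  -- upper bound to `hs`, or a condition free of `t`.
  search : ∀ ls hs vs → Dec (∃[ t ] ((All (_< t) ls × All (t <_) hs) × All (Positive (t , 1#)) vs))
  search ls hs [] = map′ (λ (t , p) → t , p , []) (λ (t , p , _) → t , p) (between? ls hs)
  search ls hs (v ∷ vs) with ray v
  ... | above l iff = map′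
        (λ { (t , (l<t ∷ ls<t , t<hs) , p) → t , (ls<t , t<hs) , Equivalence.from (iff t) l<t ∷ p })
        (λ { (t , (ls<t , t<hs) , 0<v ∷ p) → t , (Equivalence.to (iff t) 0<v ∷ ls<t , t<hs) , p })
        (search (l ∷ ls) hs vs)
  ... | below h iff = map′
        (λ { (t , (ls<t , t<h ∷ t<hs) , p) → t , (ls<t , t<hs) , Equivalence.from (iff t) t<h ∷ p })
        (λ { (t , (ls<t , t<hs) , 0<v ∷ p) → t , (ls<t , Equivalence.to (iff t) 0<v ∷ t<hs) , p })
        (search ls (h ∷ hs) vs)
  ... | level b iff = map′
        (λ { (0<b , t , q , p) → t , q , Equivalence.from (iff t) 0<b ∷ p })
        (λ { (t , q , 0<v ∷ p) → Equivalence.to (iff t) 0<v , t , q , p })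
        ((0# <? b) ×-dec search ls hs vs)

  neg : Point → Point
  neg (x , y) = - x , - y

  slope? : ∀ vs → Dec (∃[ t ] All (Positive (t , 1#)) vs)
  slope? vs = map′ (λ (t , _ , p) → t , p) (λ (t , p) → t , ([] , []) , p) (search [] [] vs)

  dot-neg : ∀ d v → dot (neg d) (neg v) ≡ dot d v
  dot-neg (a , b) (x , y) =
    solve 4 (λ a b x y → (:- a) :* (:- x) :+ (:- b) :* (:- y) := a :* x :+ b :* y) refl a b x y

  Positive-neg⁺ : ∀ d {vs} → All (Positive d) vs → All (Positive (neg d)) (map neg vs)
  Positive-neg⁺ d = All.map⁺ ∘ All.map (λ {v} → subst (0# <_) (sym (dot-neg d v)))

  dot-downward : ∀ t v → dot (t , 1#) (neg v) ≡ dot (vec (inj₂ t)) v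
  dot-downward t (x , y) = solve 3 (λ t x y →
    t :* (:- x) :+ con (ℤ.+ 1) :* (:- y) := (:- t) :* x :+ (:- con (ℤ.+ 1)) :* y) refl t x y

  downward⁺ : ∀ {t vs} → All (Positive (t , 1#)) (map neg vs) → All (Positive (vec (inj₂ t))) vs
  downward⁺ {t} = All.map (λ {v} → subst (0# <_) (dot-downward t v)) ∘ All.map⁻

  downward⁻ : ∀ {t vs} → All (Positive (vec (inj₂ t))) vs → All (Positive (t , 1#)) (map neg vs)
  downward⁻ {t} = All.map⁺ ∘ All.map (λ {v} → subst (0# <_) (sym (dot-downward t v)))

  -- A lower direction is positive on `vs` exactly if its opposite, which has the form `(t , 1#)`,
  -- is positive on the negated vectors.
  direction? : ∀ vs → Dec (∃[ d ] All (Positive (vec d)) vs)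
  direction? vs = map′
    [ (λ (t , p) → inj₁ t , p) , (λ (t , p) → inj₂ t , downward⁺ p) ]′
    (λ { (inj₁ t , p) → inj₁ (t , p) ; (inj₂ t , p) → inj₂ (t , downward⁻ p) })
    (slope? vs ⊎-dec slope? (map neg vs))

  -- A large slope t approximates the horizontal direction (1 , 0).
  steep : ∀ {a} → 0# < a → ∀ {vs} → All (Positive (a , 0#)) vs →
    ∃[ T ] (∀ t → T < t → All (Positive (t , 1#)) vs)
  steep         0<a [] = 0# , λ _ _ → []
  steep {a} 0<a {(x , y) ∷ _} (0<ax ∷ p) =
    let (T , q)   = steep 0<a p
        (l , iff) = rising 0<x y
    in
    [ (λ l≤T → T , λ t T<t → Equivalence.from (iff t) (≤-<-trans l≤T T<t) ∷ q t T<t)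
    , (λ T≤l → l , λ t l<t → Equivalence.from (iff t) l<t ∷ q t (≤-<-trans T≤l l<t)) ]′ (total l T)
    where
    0<x : 0# < x
    0<x = *-cancel-pos (<⇒≤ 0<a) (subst (0# <_)
      (solve 3 (λ a x y → a :* x :+ con (ℤ.+ 0) :* y := a :* x) refl a x y) 0<ax)

  upward : ∀ {a b vs} → 0# < b → All (Positive (a , b)) vs → ∃[ t ] All (Positive (t , 1#)) vs
  upward {a} {b} 0<b p with solution (λ { refl → <-irrefl 0<b }) a
  ... | t , bt≡a = t , All.map (λ {(x , y)} → *-cancel-pos (<⇒≤ 0<b) ∘ subst (0# <_) (scale x y)) p
    where
    open ≡-Reasoning
    scale : ∀ x y → a * x + b * y ≡ b * (t * x + 1# * y)
    scale x y = begin
      a * x + b * y             ≡⟨ cong (λ k → k * x + b * y) (sym bt≡a) ⟩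
      b * t * x + b * y         ≡⟨ solve 4 (λ b t x y → b :* t :* x :+ b :* y :=
                                     b :* (t :* x :+ con (ℤ.+ 1) :* y)) refl b t x y ⟩
      b * (t * x + 1# * y)      ∎

  rightward : ∀ {a vs} → 0# < a → All (Positive (a , 0#)) vs → ∃[ t ] All (Positive (t , 1#)) vs
  rightward 0<a p = let (T , q) = steep 0<a p in T + 1# , q _ (x<x+1 T)

  -- A direction with nonzero second coordinate only needs rescaling. A horizontal one can be
  -- tilted, because finitely many strict inequalities survive a small rotation; `steep` makes this
  -- precise. Hence `Direction` can do without horizontal directions.
  nonhorizontal : ∀ {u vs} → ¬ (proj₁ u ≡ 0# × proj₂ u ≡ 0#) → All (Positive u) vs →
    ∃[ d ] All (Positive (vec d)) vs
  nonhorizontal {a , b} {vs} u≢0 p = go (sign b) (sign a)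
    where
    up : ∃[ t ] All (Positive (t , 1#)) vs → ∃[ d ] All (Positive (vec d)) vs
    up (t , q) = inj₁ t , q
    down : ∃[ t ] All (Positive (t , 1#)) (map neg vs) → ∃[ d ] All (Positive (vec d)) vs
    down (t , q) = inj₂ t , downward⁺ q
    p⁻ : All (Positive (- a , - b)) (map neg vs)
    p⁻ = Positive-neg⁺ _ p
    -0≡0 : - 0# ≡ 0#
    -0≡0 = solve 0 (:- con (ℤ.+ 0) := con (ℤ.+ 0)) refl
    go : Sign b → Sign a → ∃[ d ] All (Positive (vec d)) vs
    go (positive 0<b) _              = up (upward 0<b p)
    go (negative b<0) _              = down (upward (0<-⁺ b<0) p⁻)
    go (null refl)    (positive 0<a) = up (rightward 0<a p)
    go (null refl)    (negative a<0) = down (rightward (0<-⁺ a<0)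
      (subst (λ z → All (Positive (- a , z)) (map neg vs)) -0≡0 p⁻))
    go (null b≡0)     (null a≡0)     = contradiction (a≡0 , b≡0) u≢0

  _∖_ : Point → Point → Point
  (x , y) ∖ (z , w) = x - z , y - w

  dot-∖ : ∀ d p r → dot d p - dot d r ≡ dot d (p ∖ r)
  dot-∖ (a , b) (x , y) (z , w) = solve 6 (λ a b x y z w →
    a :* x :+ b :* y :- (a :* z :+ b :* w) := a :* (x :- z) :+ b :* (y :- w)) refl a b x y z w

  other? : ∀ p q r → Dec (r ≢ p × r ≢ q)
  other? p q r = ¬? (r ≟P p) ×-dec ¬? (r ≟P q)

  others : List Point → Point → Point → List Point
  others S p q = filter (other? p q) S

  -- Positivity on these differences is the field `beats`, written as a finite system of strict
  -- linear inequalities in the direction.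
  margins : List Point → Point → Point → List Point
  margins S p q = map (p ∖_) (others S p q) ++ map (q ∖_) (others S p q)

  module _ {S : List Point} {d p q : Point} where

    TopTwo⇒margins : TopTwo S d p q → All (Positive d) (margins S p q)
    TopTwo⇒margins (topTwo _ _ _ beats) =
      All.++⁺ (All.map⁺ (All.map margin p-beats)) (All.map⁺ (All.map margin q-beats))
      where
      margin : ∀ {z r} → dot d r < dot d z → Positive d (z ∖ r)
      margin {z} {r} r<z = subst (0# <_) (dot-∖ d z r) (x<y⇒0<y-x r<z)
      both : All (λ r → dot d r < dot d p × dot d r < dot d q) (others S p q)
      both = All.tabulate λ r∈ → let (r∈S , r≢p , r≢q) = ∈-filter⁻ (other? p q) r∈ in beats r∈S r≢p r≢q
      p-beats = All.map proj₁ both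
      q-beats = All.map proj₂ both

    margins⇒TopTwo : p ≢ q → p ∈ S → q ∈ S → All (Positive d) (margins S p q) → TopTwo S d p q
    margins⇒TopTwo p≢q p∈S q∈S m = topTwo p≢q p∈S q∈S λ r∈S r≢p r≢q →
      let r∈ = ∈-filter⁺ (other? p q) r∈S (r≢p , r≢q) in
      beaten p (All.lookup (All.map⁻ (All.++⁻ˡ (map (p ∖_) _) m)) r∈) ,
      beaten q (All.lookup (All.map⁻ (All.++⁻ʳ (map (p ∖_) _) m)) r∈)
      where
      beaten : ∀ z {r} → Positive d (z ∖ r) → dot d r < dot d z
      beaten z {r} 0<z-r = 0<y-x⇒x<y (subst (0# <_) (sym (dot-∖ d z r)) 0<z-r)

  -- The Delaunay-edges listed in clockwise order.

  module _ (S : List Point) where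

    abstract
      topTwo? : ∀ p q → Dec (∃[ d ] TopTwo S (vec d) p q)
      topTwo? p q = map′
        (λ (p≢q , p∈S , q∈S , d , m) → d , margins⇒TopTwo p≢q p∈S q∈S m)
        (λ (d , E) → let open TopTwo E in distinct , p∈S , q∈S , d , TopTwo⇒margins E)
        (¬? (p ≟P q) ×-dec any? (p ≟P_) S ×-dec any? (q ≟P_) S ×-dec direction? (margins S p q))

    DelaunayEdge⇒direction : ∀ {p q} → DelaunayEdge S p q → ∃[ d ] TopTwo S (vec d) p q
    DelaunayEdge⇒direction e =
      let (u , u≢0 , E) = DelaunayEdge⇒TopTwo e
          (d , m)       = nonhorizontal u≢0 (TopTwo⇒margins E)
          open TopTwo E
      in d , margins⇒TopTwo distinct p∈S q∈S m

    -- An edge may be extreme in many directions; any one of them can represent it in the cyclic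
    -- order, so one is fixed here.
    record Edge : Set where
      constructor edge
      field
        ends      : Point × Point
        direction : Direction
        isTopTwo  : TopTwo S (vec direction) (proj₁ ends) (proj₂ ends)
    open Edge

    infix 4 _~_ _~?_ _~ₑ_
    _~_ : Rel (Point × Point) 0ℓ
    (p , q) ~ (p′ , q′) = SameEdge p q p′ q′

    _~?_ : Decidable _~_
    (p , q) ~? (p′ , q′) = (p ≟P p′ ×-dec q ≟P q′) ⊎-dec (p ≟P q′ ×-dec q ≟P p′)

    ~-refl : ∀ {e} → e ~ e
    ~-refl = inj₁ (refl , refl)

    ~-sym : ∀ {e f} → e ~ f → f ~ e
    ~-sym (inj₁ (refl , refl)) = inj₁ (refl , refl)
    ~-sym (inj₂ (refl , refl)) = inj₂ (refl , refl)

    ~-trans : ∀ {e f g} → e ~ f → f ~ g → e ~ g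
    ~-trans (inj₁ (refl , refl)) f~g = f~g
    ~-trans (inj₂ (refl , refl)) (inj₁ (refl , refl)) = inj₂ (refl , refl)
    ~-trans (inj₂ (refl , refl)) (inj₂ (refl , refl)) = inj₁ (refl , refl)

    _~ₑ_ : Rel Edge 0ℓ
    e ~ₑ f = ends e ~ ends f

    edgesAt : Point × Point → List Edge
    edgesAt (p , q) with topTwo? p q
    ... | yes (d , E) = edge (p , q) d E ∷ []
    ... | no _        = []

    ∈-edgesAt : ∀ {p q} → ∃[ d ] TopTwo S (vec d) p q → Any (λ e → ends e ≡ (p , q)) (edgesAt (p , q))
    ∈-edgesAt {p} {q} E with topTwo? p q
    ... | yes _ = here refl
    ... | no ¬E = contradiction E ¬E

    allEdges : List Edge
    allEdges = concatMap edgesAt (cartesianProduct S S)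

    ∈-allEdges : ∀ {p q} → DelaunayEdge S p q → Any (λ e → ends e ≡ (p , q)) allEdges
    ∈-allEdges e@(_ , p∈S , q∈S , _) = Any.concat⁺ (Any.map⁺
      (Any.map (λ { refl → ∈-edgesAt (DelaunayEdge⇒direction e) }) (∈-cartesianProduct⁺ p∈S q∈S)))

    directionOrder : DecTotalOrder 0ℓ 0ℓ 0ℓ
    directionOrder = On.decTotalOrder (⊎-<-decTotalOrder R-order R-order) direction
      where
      R-order : DecTotalOrder 0ℓ 0ℓ 0ℓ
      R-order = record { isDecTotalOrder = record { isTotalOrder = isTotalOrder ; _≟_ = _≟_ ; _≤?_ = _≤?_ } }

    open Sort directionOrder using (sort; sort-↭; sort-↗)
    open DecTotalOrder directionOrder using () renaming (_≤_ to _≼_; totalOrder to directionTotalOrder)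

    _~ₑ?_ : Decidable _~ₑ_
    e ~ₑ? f = ends e ~? ends f

    edge-Delaunay : ∀ e → DelaunayEdge S (proj₁ (ends e)) (proj₂ (ends e))
    edge-Delaunay (edge _ d E) = TopTwo⇒DelaunayEdge (vec≢0 d) E

    -- Two edges with equal directions are the same edge by `TopTwo-unique`, so the weak order
    -- produced by sorting is strict between different edges.
    strict : ∀ {d d′ p q r s} → TopTwo S (vec d) p q → TopTwo S (vec d′) r s →
      (_≤_ ⊎-< _≤_) d d′ → ¬ SameEdge p q r s → d ≺ d′
    strict E F ₁∼₂       _   = ₁∼₂
    strict E F (₁∼₁ s≤t) e≁f = ₁∼₁ (≤∧≢⇒< s≤t λ { refl → e≁f (TopTwo-unique E F) })
    strict E F (₂∼₂ s≤t) e≁f = ₂∼₂ (≤∧≢⇒< s≤t λ { refl → e≁f (TopTwo-unique E F) })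

    -- The order in `sorted` is the clockwise circle cut open at the direction `(- 1# , 0#)`: first
    -- the upper half, then the lower one.
    record Enumeration : Set where
      field
        edges    : List Edge
        complete : ∀ {p q} → DelaunayEdge S p q → ∃[ e ] (e ∈ edges × (p , q) ~ ends e)
        distinct : AllPairs (λ e f → ¬ e ~ₑ f) edges
        sorted   : AllPairs (λ e f → direction e ≺ direction f) edges

    enumeration : Enumeration
    enumeration = record { edges = edges ; complete = complete ; distinct = distinct ; sorted = sorted }
      where
      edges : List Edge
      -- `allEdges` has an entry for either order of the endpoints of an edge, possibly with
      -- different directions. Deduplication keeps the first in the sorted list.
      edges = deduplicate _~ₑ?_ (sort allEdges)

      complete : ∀ {p q} → DelaunayEdge S p q → ∃[ e ] (e ∈ edges × (p , q) ~ ends e)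
      complete {p} {q} e = find (Any.deduplicate⁺ _~ₑ?_ {P = λ e → (p , q) ~ ends e}
        (λ f~e p~e → ~-trans p~e (~-sym f~e))
        (Any-resp-↭ (↭-sym (sort-↭ allEdges)) (Any.map (λ { refl → ~-refl }) (∈-allEdges e))))

      distinct : AllPairs (λ e f → ¬ e ~ₑ f) edges
      distinct = deduplicate-! _~ₑ?_ (sort allEdges)

      sorted : AllPairs (λ e f → direction e ≺ direction f) edges
      sorted = AllPairs.map (λ {e} {f} (e≼f , e≁f) → strict (isTopTwo e) (isTopTwo f) e≼f e≁f) (AllPairs.zip
        (deduplicate-AllPairs _~ₑ?_ (Sorted⇒AllPairs directionTotalOrder (sort-↗ allEdges)) , distinct))

    -- The alternating colouring.

    module Colour (E : Enumeration) where
      open Enumeration E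

      colouring : Colouring
      colouring p q = alternate (flip _~?_ ∘ ends) edges (p , q)

      colouring-wellDefined : WellDefinedColouring S colouring
      colouring-wellDefined p q _ = alternate-cong (flip _~?_ ∘ ends)
        (λ e → mk⇔ (flipped (ends e)) (flipped (ends e))) edges
        where
        flipped : ∀ {p q} e → (p , q) ~ e → (q , p) ~ e
        flipped _ (inj₁ (refl , refl)) = inj₂ (refl , refl)
        flipped _ (inj₂ (refl , refl)) = inj₁ (refl , refl)

      -- Two edges in `H` that are neighbours in the list have different colours. If there are none,
      -- `alternation` gives edges `v` and `w` in `H` and edges `x` and `y` not in `H`, one on
      -- either arc between `v` and `w`; `crossing` puts one of these into `H` all the same.
      contains3⇒bichromatic : ∀ H → ContainsAtLeast3 S H → Bichromatic S colouring H
      contains3⇒bichromatic H (p₁ , q₁ , p₂ , q₂ , p₃ , q₃ , e₁ , e₂ , e₃ , ≁₁₂ , ≁₁₃ , ≁₂₃) =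
        [ adjacent , alternating ]′
          (alternation In? ∈₁ ∈₂ ∈₃ In₁ In₂ In₃
            (λ f₁≡f₂ → ≁₁₂ (same ~₁ ~₂ f₁≡f₂))
            (λ f₁≡f₃ → ≁₁₃ (same ~₁ ~₃ f₁≡f₃))
            (λ f₂≡f₃ → ≁₂₃ (same ~₂ ~₃ f₂≡f₃)))
        where
        In : Edge → Set
        In e = proj₁ (ends e) ∈H H × proj₂ (ends e) ∈H H

        In? : ∀ e → Dec (In e)
        In? e = (proj₁ (ends e) ∈H? H) ×-dec (proj₂ (ends e) ∈H? H)

        listed : ∀ {p q} → ContainsEdge S H p q → ∃[ e ] (e ∈ edges × (p , q) ~ ends e × In e)
        listed (e , p∈H , q∈H) with complete e
        ... | f , f∈ , inj₁ (refl , refl) = f , f∈ , inj₁ (refl , refl) , p∈H , q∈H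
        ... | f , f∈ , inj₂ (refl , refl) = f , f∈ , inj₂ (refl , refl) , q∈H , p∈H

        same : ∀ {e f x y} → e ~ ends x → f ~ ends y → x ≡ y → e ~ f
        same e~x f~y refl = ~-trans e~x (~-sym f~y)

        open Σ (listed e₁) renaming (proj₁ to f₁; proj₂ to l₁)
        open Σ (listed e₂) renaming (proj₁ to f₂; proj₂ to l₂)
        open Σ (listed e₃) renaming (proj₁ to f₃; proj₂ to l₃)
        ∈₁ = proj₁ l₁ ; ~₁ = proj₁ (proj₂ l₁) ; In₁ = proj₂ (proj₂ l₁)
        ∈₂ = proj₁ l₂ ; ~₂ = proj₁ (proj₂ l₂) ; In₂ = proj₂ (proj₂ l₂)
        ∈₃ = proj₁ l₃ ; ~₃ = proj₁ (proj₂ l₃) ; In₃ = proj₂ (proj₂ l₃)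

        adjacent : AdjacentIn In? edges → Bichromatic S colouring H
        adjacent (e , f , adj , (p∈H , q∈H) , (p′∈H , q′∈H)) =
          _ , _ , _ , _ , (edge-Delaunay e , p∈H , q∈H) , (edge-Delaunay f , p′∈H , q′∈H) ,
          alternate-adjacent (flip _~?_ ∘ ends) ends (λ _ → ~-refl)
            (AllPairs.map (λ ≁ ~ → ≁ (~-sym ~)) distinct) adj

        alternating : ∃[ v ] ∃[ x ] ∃[ w ] ∃[ y ] ∃[ es ]
          (In v × ¬ In x × In w × ¬ In y × v ∷ x ∷ w ∷ y ∷ es ⊆ edges) → Bichromatic S colouring H
        alternating (v , x , w , y , _ , v-in , x-out , w-in , y-out , sub) with AllPairs-resp-⊆ sub sorted
        ... | (v≺x ∷ _) ∷ (x≺w ∷ _) ∷ (w≺y ∷ _) ∷ _ = ⊥-elim $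
          [ (λ inside → x-out (inside (isTopTwo x))) , (λ inside → y-out (inside (isTopTwo y))) ]′
            (crossing {S} {H} v≺x x≺w w≺y (_ , _ , isTopTwo v , v-in) (_ , _ , isTopTwo w , w-in))

-- A convex lattice pentagon, with its finitely many properties checked by evaluation over the
-- integers.

module Pentagon where

  LatticePoint : Set
  LatticePoint = ℤ × ℤ

  Form : Set
  Form = ℤ × ℤ × ℤ

  infix 4 _⊨_ _⊨?_ _≟L_
  _⊨_ : Form → LatticePoint → Set
  (a , b , c) ⊨ (x , y) = c ℤ.≤ a ℤ.* x ℤ.+ b ℤ.* y

  _⊨?_ : ∀ h z → Dec (h ⊨ z)
  (a , b , c) ⊨? (x , y) = c ℤ.≤? a ℤ.* x ℤ.+ b ℤ.* y

  _≟L_ : DecidableEquality LatticePoint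
  _≟L_ = ≡-dec ℤ._≟_ ℤ._≟_
  open DecMembership _≟L_ using (_∈?_)

  vertex : Fin 5 → LatticePoint
  vertex 0F = 0ℤ , 0ℤ
  vertex 1F = 1ℤ , 0ℤ
  vertex 2F = ℤ.+ 2 , 1ℤ
  vertex 3F = 1ℤ , ℤ.+ 2
  vertex 4F = 0ℤ , 1ℤ

  next : Fin 5 → Fin 5
  next 0F = 1F
  next 1F = 2F
  next 2F = 3F
  next 3F = 4F
  next 4F = 0F

  side corner : Fin 5 → List LatticePoint
  side   i = vertex i ∷ vertex (next i) ∷ []
  corner i = vertex i ∷ vertex (next i) ∷ vertex (next (next i)) ∷ []

  -- The line through a side, bounding the halfplane on its outer side.
  sideForm : Fin 5 → Form
  sideForm 0F = 0ℤ , -1ℤ , 0ℤ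
  sideForm 1F = 1ℤ , -1ℤ , 1ℤ
  sideForm 2F = 1ℤ , 1ℤ , ℤ.+ 3
  sideForm 3F = -1ℤ , 1ℤ , 1ℤ
  sideForm 4F = -1ℤ , 0ℤ , 0ℤ

  cornerForm : Fin 5 → Form
  cornerForm 0F = 1ℤ , -1ℤ , 0ℤ
  cornerForm 1F = 1ℤ , 0ℤ , 1ℤ
  cornerForm 2F = 0ℤ , 1ℤ , 1ℤ
  cornerForm 3F = -1ℤ , 1ℤ , 0ℤ
  cornerForm 4F = -1ℤ , -1ℤ , -1ℤ

  Nonzero : Form → Set
  Nonzero (a , b , _) = ¬ (a ≡ 0ℤ × b ≡ 0ℤ)

  nonzero? : ∀ h → Dec (Nonzero h)
  nonzero? (a , b , _) = ¬? (a ℤ.≟ 0ℤ ×-dec b ℤ.≟ 0ℤ)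

  Cuts : Form → List LatticePoint → Set
  Cuts h zs = ∀ i → (h ⊨ vertex i → vertex i ∈ zs) × (vertex i ∈ zs → h ⊨ vertex i)

  cuts? : ∀ h zs → Dec (Cuts h zs)
  cuts? h zs = Fin.all? λ i → (h ⊨? vertex i →-dec vertex i ∈? zs) ×-dec (vertex i ∈? zs →-dec h ⊨? vertex i)

  side-nonzero : ∀ i → Nonzero (sideForm i)
  side-nonzero = from-yes (Fin.all? (nonzero? ∘ sideForm))

  corner-nonzero : ∀ i → Nonzero (cornerForm i)
  corner-nonzero = from-yes (Fin.all? (nonzero? ∘ cornerForm))

  side-cut : ∀ i → Cuts (sideForm i) (side i)
  side-cut = from-yes (Fin.all? λ i → cuts? (sideForm i) (side i))

  corner-cut : ∀ i → Cuts (cornerForm i) (corner i)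
  corner-cut = from-yes (Fin.all? λ i → cuts? (cornerForm i) (corner i))

  vertex-injective : ∀ {i j} → vertex i ≡ vertex j → i ≡ j
  vertex-injective {i} {j} = from-yes (Fin.all? λ i → Fin.all? λ j → vertex i ≟L vertex j →-dec i Fin.≟ j) i j

  -- The weighted mean times the total weight, which keeps the coordinates integral. Successors make
  -- the weights positive.
  combine : ℕ → LatticePoint → ℕ → LatticePoint → LatticePoint
  combine k (x , y) l (z , w) =
    ℤ.+ suc k ℤ.* x ℤ.+ ℤ.+ suc l ℤ.* z , ℤ.+ suc k ℤ.* y ℤ.+ ℤ.+ suc l ℤ.* w

  -- The diagonal from vertex i to the next but one meets the diagonal of the two named vertices
  -- in the weighted mean with weights suc k and suc l.
  crossed : Fin 5 → ℕ × ℕ × Fin 5 × Fin 5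
  crossed 0F = 1 , 0 , 1F , 4F
  crossed 1F = 0 , 0 , 2F , 4F
  crossed 2F = 0 , 0 , 1F , 3F
  crossed 3F = 0 , 1 , 1F , 4F
  crossed 4F = 0 , 1 , 2F , 0F

  Crosses : Fin 5 → Fin 5 → ℕ × ℕ × Fin 5 × Fin 5 → Set
  Crosses i j (k , l , r , s) =
    (r ≢ i × r ≢ j) × (s ≢ i × s ≢ j) ×
    combine k (vertex i) l (vertex j) ≡ combine k (vertex r) l (vertex s)

  crosses : ∀ i → Crosses i (next (next i)) (crossed i)
  crosses = from-yes (Fin.all? λ i → let (k , l , r , s) = crossed i ; j = next (next i) in
    (¬? (r Fin.≟ i) ×-dec ¬? (r Fin.≟ j)) ×-dec (¬? (s Fin.≟ i) ×-dec ¬? (s Fin.≟ j)) ×-dec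
    combine k (vertex i) l (vertex j) ≟L combine k (vertex r) l (vertex s))

  next-≢ : ∀ i → i ≢ next i
  next-≢ = from-yes (Fin.all? λ i → ¬? (i Fin.≟ next i))

  next²-≢ : ∀ i → i ≢ next (next i)
  next²-≢ = from-yes (Fin.all? λ i → ¬? (i Fin.≟ next (next i)))

≢-≢⇒≡ : ∀ {x y z : Bool} → x ≢ y → y ≢ z → x ≡ z
≢-≢⇒≡ x≢y y≢z = trans (¬-not x≢y) (trans (cong not (¬-not y≢z)) (not-involutive _))

-- The pentagon over `R`, and the odd cycle formed by its sides.

module Counterexample (R : RealField) where
  open OrderedField R
  open RingSolver using (solve; _:=_; _:+_; _:*_; _:-_; :-_; con)
  open Plane R
  open Geometry R using (dot; DelaunayEdge⇒TopTwo; TopTwo)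
  open Pentagon

  embed : LatticePoint → Point
  embed (x , y) = ι x , ι y

  embed-injective : ∀ {z w} → embed z ≡ embed w → z ≡ w
  embed-injective eq = cong₂ _,_ (ι-injective (cong proj₁ eq)) (ι-injective (cong proj₂ eq))

  P : Fin 5 → Point
  P = embed ∘ vertex

  P-injective : ∀ {i j} → P i ≡ P j → i ≡ j
  P-injective = vertex-injective ∘ embed-injective

  S : List Point
  S = tabulate P

  S-unique : Unique S
  S-unique = Unique.tabulate⁺ P-injective

  halfplaneOf : ∀ h → Nonzero h → Halfplane
  halfplaneOf (a , b , c) h≢0 = halfplane (ι a) (ι b) (ι c)
    λ (a≡0 , b≡0) → h≢0 (ι-injective a≡0 , ι-injective b≡0)

  ι-form : ∀ a b x y → ι (a ℤ.* x ℤ.+ b ℤ.* y) ≡ ι a * ι x + ι b * ι y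
  ι-form a b x y = trans (ι-+ (a ℤ.* x) (b ℤ.* y)) (cong₂ _+_ (ι-* a x) (ι-* b y))

  embed-∈⁺ : ∀ {h z} (h≢0 : Nonzero h) → h ⊨ z → embed z ∈H halfplaneOf h h≢0
  embed-∈⁺ {a , b , c} {x , y} _ c≤ = subst (ι c ≤_) (ι-form a b x y) (ι-mono-≤ c≤)

  embed-∈⁻ : ∀ {h z} (h≢0 : Nonzero h) → embed z ∈H halfplaneOf h h≢0 → h ⊨ z
  embed-∈⁻ {a , b , c} {x , y} _ c≤ = ι-cancel-≤ (subst (ι c ≤_) (sym (ι-form a b x y)) c≤)

  side-Delaunay : ∀ i → DelaunayEdge S (P i) (P (next i))
  side-Delaunay i = next-≢ i ∘ P-injective , ∈-tabulate⁺ {f = P} i , ∈-tabulate⁺ {f = P} (next i) ,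
    halfplaneOf (sideForm i) (side-nonzero i) , λ r r∈S → cut r (∈-tabulate⁻ {f = P} r∈S)
    where
    cut : ∀ r → ∃[ j ] r ≡ P j → r ∈H halfplaneOf (sideForm i) (side-nonzero i) ⇔ (r ≡ P i ⊎ r ≡ P (next i))
    cut _ (j , refl) = mk⇔
      (λ r∈H → ends (proj₁ (side-cut i j) (embed-∈⁻ (side-nonzero i) r∈H)))
      [ (λ eq → embed-∈⁺ (side-nonzero i) (proj₂ (side-cut i j) (here (embed-injective eq))))
      , (λ eq → embed-∈⁺ (side-nonzero i) (proj₂ (side-cut i j) (there (here (embed-injective eq))))) ]′
      where
      ends : vertex j ∈ side i → P j ≡ P i ⊎ P j ≡ P (next i)
      ends (here eq)         = inj₁ (cong embed eq)
      ends (there (here eq)) = inj₂ (cong embed eq)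

  -- If the ends of the diagonal were the top two in a direction `d`, each end of the crossing
  -- diagonal would lose to both of them, and so would any weighted mean. But the two diagonals
  -- share a point, with the same weights on both.
  diagonal-¬Delaunay : ∀ i → ¬ DelaunayEdge S (P i) (P (next (next i)))
  diagonal-¬Delaunay i e =
    let (d , _ , E) = DelaunayEdge⇒TopTwo e
        (k , l , r , s) = crossed i
        ((r≢i , r≢j) , (s≢i , s≢j) , eq) = crosses i
        open TopTwo E
        r<i = proj₁ (beats (∈-tabulate⁺ {f = P} r) (r≢i ∘ P-injective) (r≢j ∘ P-injective))
        s<j = proj₂ (beats (∈-tabulate⁺ {f = P} s) (s≢i ∘ P-injective) (s≢j ∘ P-injective))
    in <-irrefl (<-≤-trans (weighted (ι-pos k) (ι-pos l) r<i s<j) (≤-reflexive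
         (trans (sym (dot-combine d k (vertex i) l (vertex (next (next i)))))
           (trans (cong (dot d ∘ embed) eq) (dot-combine d k (vertex r) l (vertex s))))))
    where
    dot-combine : ∀ d k z l w → dot d (embed (combine k z l w)) ≡
      ι (ℤ.+ suc k) * dot d (embed z) + ι (ℤ.+ suc l) * dot d (embed w)
    dot-combine (a , b) k (x , y) l (z , w) = trans
      (cong₂ (λ u v → a * u + b * v)
        (ι-form (ℤ.+ suc k) (ℤ.+ suc l) x z) (ι-form (ℤ.+ suc k) (ℤ.+ suc l) y w))
      (solve 8 (λ a b k l x y z w → a :* (k :* x :+ l :* z) :+ b :* (k :* y :+ l :* w) :=
        k :* (a :* x :+ b :* y) :+ l :* (a :* z :+ b :* w))
        refl a b (ι (ℤ.+ suc k)) (ι (ℤ.+ suc l)) (ι x) (ι y) (ι z) (ι w))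
    weighted : ∀ {k l x y z w} → 0# < k → 0# < l → x < y → z < w → k * x + l * z < k * y + l * w
    weighted {k} {l} {x} {y} {z} {w} 0<k 0<l x<y z<w = 0<y-x⇒x<y (subst (0# <_)
      (solve 6 (λ k l x y z w → k :* (y :- x) :+ l :* (w :- z) := k :* y :+ l :* w :- (k :* x :+ l :* z))
        refl k l x y z w)
      (+-pos-nonneg (*-pos 0<k (x<y⇒0<y-x x<y)) (<⇒≤ (*-pos 0<l (x<y⇒0<y-x z<w)))))

  DelaunayEdge-sym : ∀ {p q} → DelaunayEdge S p q → DelaunayEdge S q p
  DelaunayEdge-sym (p≢q , p∈S , q∈S , H , cut) = p≢q ∘ sym , q∈S , p∈S , H ,
    λ r r∈S → let open Equivalence (cut r r∈S) in mk⇔ (Sum.swap ∘ to) (from ∘ Sum.swap)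

  module _ (χ : Colouring) (χ-sym : WellDefinedColouring S χ)
           (bichromatic : ∀ H → ContainsAtLeast2 S H → Bichromatic S χ H) where

    sideColour : Fin 5 → Bool
    sideColour i = χ (P i) (P (next i))

    -- The vertices in the corner halfplane are `a`, `b`, `c`, and the pair `a`, `c` is a diagonal,
    -- so its only edges are two neighbouring sides. If these had the same colour, it would contain
    -- two edges but only one colour.
    consecutive-≢ : ∀ i → sideColour i ≢ sideColour (next i)
    consecutive-≢ i same = differ (bichromatic H
      ( a , b , b , c , (side-Delaunay i , a∈H , b∈H) , (side-Delaunay (next i) , b∈H , c∈H)
      , [ (λ (a≡b , _) → next-≢ i (P-injective a≡b)) , (λ (a≡c , _) → next²-≢ i (P-injective a≡c)) ]′))
      where
      H = halfplaneOf (cornerForm i) (corner-nonzero i)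
      a = P i
      b = P (next i)
      c = P (next (next i))
      in-corner : ∀ j → vertex j ∈ corner i → P j ∈H H
      in-corner j j∈ = embed-∈⁺ (corner-nonzero i) (proj₂ (corner-cut i j) j∈)
      a∈H = in-corner i (here refl)
      b∈H = in-corner (next i) (there (here refl))
      c∈H = in-corner (next (next i)) (there (there (here refl)))

      corner-point : ∀ {r} → r ∈ S → r ∈H H → r ∈ a ∷ b ∷ c ∷ []
      corner-point r∈S r∈H with ∈-tabulate⁻ {f = P} r∈S
      ... | j , refl = ∈-map⁺ embed (proj₁ (corner-cut i j) (embed-∈⁻ (corner-nonzero i) r∈H))

      colour : ∀ {p q} → ContainsEdge S H p q → χ p q ≡ sideColour i
      colour (e@(p≢q , p∈S , q∈S , _) , p∈H , q∈H) with corner-point p∈S p∈H | corner-point q∈S q∈H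
      ... | here refl                 | here refl                 = contradiction refl p≢q
      ... | here refl                 | there (here refl)         = refl
      ... | here refl                 | there (there (here refl)) = contradiction e (diagonal-¬Delaunay i)
      ... | there (here refl)         | here refl                 = χ-sym b a e
      ... | there (here refl)         | there (here refl)         = contradiction refl p≢q
      ... | there (here refl)         | there (there (here refl)) = sym same
      ... | there (there (here refl)) | here refl                 =
            contradiction (DelaunayEdge-sym e) (diagonal-¬Delaunay i)
      ... | there (there (here refl)) | there (here refl)         = trans (χ-sym c b e) (sym same)
      ... | there (there (here refl)) | there (there (here refl)) = contradiction refl p≢q

      differ : ¬ Bichromatic S χ H
      differ (_ , _ , _ , _ , e , e′ , χ≢) = χ≢ (trans (colour e) (sym (colour e′)))

    -- Colours repeat at every second side, so sides `0F`, `2F` and `4F` agree; but `4F` and `0F`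
    -- are neighbours.
    odd-cycle : ⊥
    odd-cycle = consecutive-≢ 4F (sym (trans
      (≢-≢⇒≡ (consecutive-≢ 0F) (consecutive-≢ 1F)) (≢-≢⇒≡ (consecutive-≢ 2F) (consecutive-≢ 3F))))

theorem2 : (R : RealField) → let open Plane R in
    ((S : List Point) → Unique S →
    ∃[ χ ] (WellDefinedColouring S χ ×
    (∀ H → ContainsAtLeast3 S H → Bichromatic S χ H)))
    ×
    (∃[ S ] (Unique S ×
    ((χ : Colouring) → WellDefinedColouring S χ →
    ¬ (∀ H → ContainsAtLeast2 S H → Bichromatic S χ H))))
theorem2 R =
  (λ S _ → let open DelaunayEdges.Colour R S (DelaunayEdges.enumeration R S) in
    colouring , colouring-wellDefined , contains3⇒bichromatic) ,
  S , S-unique , odd-cycle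
  where open Counterexample R
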